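{- Let $a\ge 2$, $c>0$, $d$ be integers with $d<ca$ and $\gcd(d,a)=\gcd(d,c)=1$, let $n\ge 1$, and let $\mathbf s_j=ca^{n+j}-d$ for $j\in\mathbb N$ and $S_n=\langle\{\mathbf s_j:j\in\mathbb N\}\rangle$. Let $m=e(S_n)$, assume $m\ge2$, let $\lambda=\gcd(S_n)$, and assume that $\mathbf R_m\le\mathbf s_1/\lambda$. Then Wilf's conjecture holds for the numerical semigroup $S=(1/\lambda)S_n$, that is, $$\mathrm F(S)+1\le n(S)\cdot e(S),$$ where $n(S)$ is the number of elements of $S$ less than $\mathrm F(S)$.
   Context: $\mathbb N=\{0,1,2,\ldots\}$. For $A\subseteq\mathbb N$, $\langle A\rangle$ is the submonoid of $(\mathbb N,+)$ generated by $A$. For a nontrivial submonoid $M$ of $\mathbb N$, the minimal generating set of $M$ is the unique generating set contained in every generating set of $M$ (its elements are the nonzero elements of $M$ that are not sums of two nonzero elements of $M$; it is finite), and $e(M)$ is its cardinality. $\gcd(M)$ denotes the greatest common divisor of all elements of $M$, and with $\lambda=\gcd(M)$, $(1/\lambda)M=\{x/\lambda:x\in M\}$, which is a numerical semigroup (a submonoid of $\mathbb N$ with finite complement). For a numerical semigroup $S$, the Frobenius number $\mathrm F(S)$ is the largest element of $\mathbb N\setminus S$. The repunit numbers in base $a$ are $\mathbf R_0=0$ and $\mathbf R_k=1+a+\cdots+a^{k-1}$ for $k\ge1$. -}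

module Defs where

open import Data.Integer as ℤ using (ℤ; +_)
open import Data.List using (length)
open import Data.List.Membership.Propositional using () renaming (_∈_ to _∈ˡ_)
open import Data.List.Relation.Unary.Unique.Propositional using (Unique)
open import Data.Nat using (ℕ; zero; suc; _+_; _*_; _^_; _≤_; _<_; _/_; NonZero)
open import Data.Nat.Divisibility using (_∣_)
open import Data.Product using (∃-syntax; _×_)
open import Function.Bundles using (_⇔_)
open import Level using (0ℓ) renaming (suc to lsuc)
open import Relation.Binary.PropositionalEquality using (_≡_)
open import Relation.Unary using (Pred; _∈_; _∉_; _⊆_; _≐_)

data ⟨_⟩ (A : Pred ℕ 0ℓ) : Pred ℕ 0ℓ where
  gen : ∀ {x} → x ∈ A → x ∈ ⟨ A ⟩
  0∈  : 0 ∈ ⟨ A ⟩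
  add : ∀ {x y} → x ∈ ⟨ A ⟩ → y ∈ ⟨ A ⟩ → x + y ∈ ⟨ A ⟩

_Generates_ : Pred ℕ 0ℓ → Pred ℕ 0ℓ → Set
A Generates M = ⟨ A ⟩ ≐ M

IsMinimalGeneratingSet : Pred ℕ 0ℓ → Pred ℕ 0ℓ → Set (lsuc 0ℓ)
IsMinimalGeneratingSet M A = A Generates M × (∀ B → B Generates M → A ⊆ B)

HasCardinality : Pred ℕ 0ℓ → ℕ → Set
HasCardinality P k =
  ∃[ xs ] Unique xs × (∀ x → (x ∈ˡ xs) ⇔ (x ∈ P)) × length xs ≡ k

-- The invariants e(M), gcd(M), F(S), n(S) are given as relations that
-- determine their value uniquely, since a bare predicate on ℕ need not be
-- decidable.

-- e(M) = k
IsEmbeddingDimension : Pred ℕ 0ℓ → ℕ → Set (lsuc 0ℓ)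
IsEmbeddingDimension M k = ∃[ A ] IsMinimalGeneratingSet M A × HasCardinality A k

-- gcd(M) = g
IsGCD : Pred ℕ 0ℓ → ℕ → Set
IsGCD M g = (∀ x → x ∈ M → g ∣ x) × (∀ h → (∀ x → x ∈ M → h ∣ x) → h ∣ g)

-- (1/g)M.  The division is truncated in general; it is exact when g divides
-- every element of M.
1/_·_ : (g : ℕ) .{{_ : NonZero g}} → Pred ℕ 0ℓ → Pred ℕ 0ℓ
(1/ g · M) y = ∃[ x ] x ∈ M × y ≡ x / g

-- F(S) = f
IsFrobenius : Pred ℕ 0ℓ → ℕ → Set
IsFrobenius S f = f ∉ S × (∀ x → x ∉ S → x ≤ f)

-- The Frobenius number exists in ℕ only when S ≠ ℕ, so this is to be used for
-- semigroups other than ℕ; the existence of F(S), n(S) and e(S) is part of the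
-- assertion.
Wilf : Pred ℕ 0ℓ → Set (lsuc 0ℓ)
Wilf S = ∃[ f ] ∃[ k ] ∃[ e ]
  IsFrobenius S f ×
  HasCardinality (λ x → x ∈ S × x < f) k ×
  IsEmbeddingDimension S e ×
  f + 1 ≤ k * e

-- R a k = 1 + a + ⋯ + a ^ (k - 1), the repunit numbers in base a
R : ℕ → ℕ → ℕ
R a zero    = 0
R a (suc k) = R a k + a ^ k

-- s_j = c a^(n+j) - d, an integer because d may have either sign
s : (a c : ℕ) (d : ℤ) (n : ℕ) → ℕ → ℤ
s a c d n j = + (c * a ^ (n + j)) ℤ.- d

𝕊 : (a c : ℕ) (d : ℤ) (n : ℕ) → Pred ℕ 0ℓ
𝕊 a c d n = ⟨ (λ x → ∃[ j ] + x ≡ s a c d n j) ⟩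

{-# OPTIONS --safe #-}

-- Put M = s₀ / λ and B = (a - 1) c aⁿ / λ, so that s_j / λ = M + B R_j and S is the
-- set of all k M + B q such that q is a sum of at most k repunits.  With
-- β(h) = Σ_{i < m-1} ⌊h / aⁱ⌋ and η(q) = min {h : q ≤ β(h)}, the least number of
-- repunits among R_1, …, R_{m-1} with sum q is κ(q) = a η(q) - (a - 1) q.
--
-- As m = e(S), the m + 1 elements s_0 / λ, …, s_m / λ are not all irreducible, which
-- forces M ≤ R_m; together with R_m ≤ M + B this gives that S is generated by the
-- first m of them and that the w(q) = B q + κ(q) M, q < M, form the Apéry set of M.
--
-- Let ℓ(q) = β(η(q)) - q.  Then ℓ(q) < m - 1, a^ℓ(q) divides η(q), and
-- w(q + R_{ℓ(q)+1}) - w(q) ∈ S as long as q + R_{ℓ(q)+1} < M.  Two numbers q with the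
-- same ℓ = ℓ(q) differ by at least R_{ℓ+1}, so at most one q < M per value of ℓ cannot
-- be increased in this way.  Hence every gap x of S has the form w(q) - M - s with
-- s ∈ S and q one of at most m - 1 numbers, which gives F + 1 ≤ n(S) (1 + (m - 1)).
module Submission where

open import Defs
open import Data.Fin using (Fin; toℕ; fromℕ<; combine)
open import Data.Fin.Properties using (injective⇒≤; combine-injective; toℕ-injective; toℕ-fromℕ<; toℕ<n)
open import Data.Integer as ℤ using (ℤ; +_; -[1+_]; 1ℤ; _/ℕ_)
open import Data.Integer.GCD using (gcd)
import Data.Integer.Properties as ℤ
open import Data.List using (List; []; _∷_; length; map; upTo; filter)
open import Data.List.Membership.Propositional using () renaming (_∈_ to _∈ˡ_)
open import Data.List.Membership.Propositional.Properties
  using (∈-filter⁺; ∈-filter⁻; ∈-upTo⁺; ∈-upTo⁻; ∈-map⁺; ∈-map⁻)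
import Data.List.Membership.Setoid.Properties as Membership
open import Data.List.Properties using (length-map)
open import Data.List.Relation.Unary.All using (_∷_)
open import Data.List.Relation.Unary.AllPairs using (_∷_)
open import Data.List.Relation.Unary.Any using (here; there; index)
import Data.List.Relation.Unary.Unique.Propositional.Properties as Unique
open import Data.Nat using (ℕ; zero; suc; _+_; _*_; _∸_; _^_; _≤_; _<_; _/_; _%_; NonZero;
  z≤n; s≤s; z<s; s<s; s≤s⁻¹; >-nonZero; ≢-nonZero)
open import Data.Nat.Coprimality using (Coprime; coprime-Bézout; coprime-divisor)
open import Data.Nat.Divisibility using (_∣_; divides; 1∣_; _∣0; m∣m*n; n∣m*n; >⇒∤; ∣1⇒≡1;
  ∣m⇒∣m*n; ∣m∣n⇒∣m+n; ∣m+n∣m⇒∣n; *-monoʳ-∣; *-monoˡ-∣; *-cancelʳ-∣)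
open import Data.Nat.DivMod using (/-monoˡ-≤; m*n/n≡m; m/n*n≤m; m%n<n; m≡m%n+[m/n]*n; m<n⇒m/n≡0;
  m<n*o⇒m/o<n; +-distrib-/-∣ˡ; +-distrib-/-∣ʳ)
open import Data.Nat.GCD using (module Bézout)
open import Data.Nat.Induction using (<-rec)
open import Data.Nat.Properties
open import Data.Nat.Tactic.RingSolver using (solve-∀)
open import Data.Product using (∃-syntax; _×_; _,_; proj₁; proj₂)
open import Data.Sum using (_⊎_; inj₁; inj₂)
open import Function.Bundles using (mk⇔; Equivalence)
open import Level using (0ℓ)
open import Relation.Binary.Definitions using (tri<; tri≈; tri>)
open import Relation.Binary.PropositionalEquality
open import Relation.Nullary using (¬_; Dec; yes; no; contradiction)
open import Relation.Unary using (Pred; _∈_; _∉_; _⊆_; _≐_)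

-- Repunits and sums of iterated quotients by `a`.

module Repunit (b : ℕ) where

  a : ℕ
  a = suc b

  b*R+1 : ∀ j → b * R a j + 1 ≡ a ^ j
  b*R+1 zero    = cong (_+ 1) (*-zeroʳ b)
  b*R+1 (suc j) = begin
    b * (R a j + a ^ j) + 1     ≡⟨ eq b (R a j) (a ^ j) ⟩
    (b * R a j + 1) + b * a ^ j ≡⟨ cong (_+ b * a ^ j) (b*R+1 j) ⟩
    a ^ suc j                   ∎
    where
    open ≡-Reasoning
    eq : ∀ x y z → x * (y + z) + 1 ≡ (x * y + 1) + x * z
    eq = solve-∀

  R-suc : ∀ j → R a (suc j) ≡ 1 + a * R a j
  R-suc j = begin
    R a j + a ^ j             ≡⟨ cong (λ t → R a j + t) (b*R+1 j) ⟨
    R a j + (b * R a j + 1)   ≡⟨ eq b (R a j) ⟩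
    1 + a * R a j             ∎
    where
    open ≡-Reasoning
    eq : ∀ x y → y + (x * y + 1) ≡ 1 + (1 + x) * y
    eq = solve-∀

  0<a^ : ∀ j → 0 < a ^ j
  0<a^ j = m^n>0 a j

  R-< : ∀ j → R a j < R a (suc j)
  R-< j = m<m+n (R a j) (0<a^ j)

  0<R : ∀ j → 0 < R a (suc j)
  0<R j = <-≤-trans (0<a^ j) (m≤n+m _ (R a j))

  R-mono-≤ : ∀ {i j} → i ≤ j → R a i ≤ R a j
  R-mono-≤ {j = zero}  z≤n = ≤-refl
  R-mono-≤ {j = suc j} i≤1+j with m≤n⇒m<n∨m≡n i≤1+j
  ... | inj₁ i<1+j = ≤-trans (R-mono-≤ (s≤s⁻¹ i<1+j)) (<⇒≤ (R-< j))
  ... | inj₂ refl  = ≤-refl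

  R-mono-< : ∀ {i j} → i < j → R a i < R a j
  R-mono-< {i} i<j = <-≤-trans (R-< i) (R-mono-≤ i<j)

  R-injective : ∀ {i j} → R a i ≡ R a j → i ≡ j
  R-injective {i} {j} eq with <-cmp i j
  ... | tri< i<j _ _ = contradiction eq (<⇒≢ (R-mono-< i<j))
  ... | tri≈ _ i≡j _ = i≡j
  ... | tri> _ _ j<i = contradiction (sym eq) (<⇒≢ (R-mono-< j<i))

  -- β r h = ⌊h / a⁰⌋ + ⋯ + ⌊h / a^(r-1)⌋
  β : ℕ → ℕ → ℕ
  β zero    h = 0
  β (suc r) h = h + β r (h / a)

  β-mono : ∀ r {x y} → x ≤ y → β r x ≤ β r y
  β-mono zero    x≤y = z≤n
  β-mono (suc r) x≤y = +-mono-≤ x≤y (β-mono r (/-monoˡ-≤ a x≤y))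

  β-zero : ∀ r → β r 0 ≡ 0
  β-zero zero    = refl
  β-zero (suc r) = β-zero r

  m*k/m : ∀ k → a * k / a ≡ k
  m*k/m k = trans (cong (_/ a) (*-comm a k)) (m*n/n≡m k a)

  [m+ak]/a : ∀ m k → (m + a * k) / a ≡ m / a + k
  [m+ak]/a m k = trans (+-distrib-/-∣ʳ m (m∣m*n k)) (cong (λ t → m / a + t) (m*k/m k))

  /-superadditive : ∀ x y → x / a + y / a ≤ (x + y) / a
  /-superadditive x y = begin
    x / a + y / a               ≡⟨ m*n/n≡m _ a ⟨
    (x / a + y / a) * a / a     ≡⟨ cong (_/ a) (*-distribʳ-+ a (x / a) (y / a)) ⟩
    (x / a * a + y / a * a) / a ≤⟨ /-monoˡ-≤ a (+-mono-≤ (m/n*n≤m x a) (m/n*n≤m y a)) ⟩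
    (x + y) / a                 ∎
    where open ≤-Reasoning

  β-superadditive : ∀ r x y → β r x + β r y ≤ β r (x + y)
  β-superadditive zero    x y = z≤n
  β-superadditive (suc r) x y = begin
    x + β r (x / a) + (y + β r (y / a))   ≡⟨ eq x _ y _ ⟩
    x + y + (β r (x / a) + β r (y / a))   ≤⟨ +-monoʳ-≤ (x + y) (β-superadditive r (x / a) (y / a)) ⟩
    x + y + β r (x / a + y / a)           ≤⟨ +-monoʳ-≤ (x + y) (β-mono r (/-superadditive x y)) ⟩
    x + y + β r ((x + y) / a)             ∎
    where
    open ≤-Reasoning
    eq : ∀ p q r s → p + q + (r + s) ≡ p + r + (q + s)
    eq = solve-∀

  -- The quotients by `a ^ i` with `i ≤ ℓ` gain exactly `a ^ (ℓ - i)`, which sums to `R a (suc ℓ)`;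
  -- the later ones do not decrease.
  β-+^-≥ : ∀ {r} ℓ h → ℓ < r → β r h + R a (suc ℓ) ≤ β r (h + a ^ ℓ)
  β-+^-≥ {suc r} zero h _ = begin
    h + β r (h / a) + 1       ≡⟨ eq h _ ⟩
    h + 1 + β r (h / a)       ≤⟨ +-monoʳ-≤ (h + 1) (β-mono r (/-monoˡ-≤ a (m≤m+n h 1))) ⟩
    h + 1 + β r ((h + 1) / a) ∎
    where
    open ≤-Reasoning
    eq : ∀ x y → x + y + 1 ≡ x + 1 + y
    eq = solve-∀
  β-+^-≥ {suc r} (suc ℓ) h (s≤s ℓ<r) = begin
    h + β r (h / a) + (R a (suc ℓ) + a ^ suc ℓ) ≡⟨ eq h _ _ (a ^ suc ℓ) ⟩
    h + a ^ suc ℓ + (β r (h / a) + R a (suc ℓ)) ≤⟨ +-monoʳ-≤ (h + a ^ suc ℓ) (β-+^-≥ ℓ (h / a) ℓ<r) ⟩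
    h + a ^ suc ℓ + β r (h / a + a ^ ℓ)         ≡⟨ cong (λ t → h + a ^ suc ℓ + β r t) ([m+ak]/a h (a ^ ℓ)) ⟨
    h + a ^ suc ℓ + β r ((h + a ^ suc ℓ) / a)   ∎
    where
    open ≤-Reasoning
    eq : ∀ x y z w → x + y + (z + w) ≡ x + w + (y + z)
    eq = solve-∀

  β-+^-top : ∀ r h → β (suc r) (h + a ^ r) ≡ β (suc r) h + R a (suc r)
  β-+^-top zero    h = eq h
    where
    eq : ∀ x → x + 1 + 0 ≡ x + 0 + 1
    eq = solve-∀
  β-+^-top (suc r) h = begin
    h + a ^ suc r + β (suc r) ((h + a ^ suc r) / a)
      ≡⟨ cong (λ t → h + a ^ suc r + β (suc r) t) ([m+ak]/a h (a ^ r)) ⟩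
    h + a ^ suc r + β (suc r) (h / a + a ^ r)         ≡⟨ cong (λ t → h + a ^ suc r + t) (β-+^-top r (h / a)) ⟩
    h + a ^ suc r + (β (suc r) (h / a) + R a (suc r)) ≡⟨ eq h (a ^ suc r) (β (suc r) (h / a)) _ ⟩
    h + β (suc r) (h / a) + (R a (suc r) + a ^ suc r) ∎
    where
    open ≡-Reasoning
    eq : ∀ x y z w → x + y + (z + w) ≡ x + z + (w + y)
    eq = solve-∀

  -- The `r` quotients gain `a ^ r`, ..., `a`, so only the summand 1 of `R a (suc r)` is missing.
  β-+^-above : ∀ r h → β r (h + a ^ r) + 1 ≡ β r h + R a (suc r)
  β-+^-above zero    h = refl
  β-+^-above (suc r) h = begin
    h + a ^ suc r + β r ((h + a ^ suc r) / a) + 1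
      ≡⟨ cong (λ t → h + a ^ suc r + β r t + 1) ([m+ak]/a h (a ^ r)) ⟩
    h + a ^ suc r + β r (h / a + a ^ r) + 1       ≡⟨ +-assoc (h + a ^ suc r) _ 1 ⟩
    h + a ^ suc r + (β r (h / a + a ^ r) + 1)     ≡⟨ cong (λ t → h + a ^ suc r + t) (β-+^-above r (h / a)) ⟩
    h + a ^ suc r + (β r (h / a) + R a (suc r))   ≡⟨ eq h (a ^ suc r) (β r (h / a)) _ ⟩
    h + β r (h / a) + (R a (suc r) + a ^ suc r)   ∎
    where
    open ≡-Reasoning
    eq : ∀ x y z w → x + y + (z + w) ≡ x + z + (w + y)
    eq = solve-∀

  β-a^ : ∀ r → β r (a ^ r) + 1 ≡ R a (suc r)
  β-a^ r = trans (β-+^-above r 0) (cong (_+ R a (suc r)) (β-zero r))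

  [ak+b]/a : ∀ k → (a * k + b) / a ≡ k
  [ak+b]/a k = begin
    (a * k + b) / a   ≡⟨ +-distrib-/-∣ˡ b (m∣m*n k) ⟩
    a * k / a + b / a ≡⟨ cong₂ _+_ (m*k/m k) (m<n⇒m/n≡0 (n<1+n b)) ⟩
    k + 0             ≡⟨ +-identityʳ k ⟩
    k                 ∎
    where open ≡-Reasoning

  -- Just before the carry at `a ^ ℓ`, the quotient by `a ^ i` with `i ≤ ℓ` has gained
  -- `a ^ (ℓ - i) - 1` and the later ones nothing. The `suc ℓ` subtracted ones are the deficit.
  β-below-carry : ∀ {r} ℓ u x → ℓ < r → suc x ≡ a ^ ℓ →
    β r (a ^ ℓ * u + x) + suc ℓ ≤ β r (a ^ ℓ * u) + R a (suc ℓ)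
  β-below-carry {suc r} zero u zero _ refl =
    ≤-reflexive (cong (λ t → β (suc r) t + 1) (+-identityʳ (1 * u)))
  -- Writing `a ^ ℓ` as `suc y` gives `x ≡ a * y + b`, so that `y` plays the role of `x` one level
  -- down.
  β-below-carry {suc r} (suc ℓ) u x (s≤s ℓ<r) 1+x≡ with a ^ ℓ in a^ℓ | 0<a^ ℓ
  ... | suc y | _ = begin
    H + x + β r ((H + x) / a) + suc (suc ℓ)   ≡⟨ cong (λ t → H + x + β r t + suc (suc ℓ)) /a ⟩
    H + x + β r (P * u + y) + suc (suc ℓ)     ≡⟨ eq H x _ (suc ℓ) ⟩
    H + suc x + (β r (P * u + y) + suc ℓ)     ≤⟨ +-monoʳ-≤ (H + suc x) IH ⟩
    H + suc x + (β r (P * u) + (R a ℓ + P))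
      ≡⟨ cong₂ (λ s t → H + s + (t + (R a ℓ + P))) 1+x≡ (cong (β r) H/a) ⟩
    H + a * P + (β r (H / a) + (R a ℓ + P))   ≡⟨ eq′ H (a * P) (β r (H / a)) _ ⟩
    H + β r (H / a) + (R a ℓ + P + a * P)     ∎
    where
    open ≤-Reasoning
    P = suc y
    H = a * P * u
    eq : ∀ p q r s → p + q + r + suc s ≡ p + suc q + (r + s)
    eq = solve-∀
    eq′ : ∀ p q r s → p + q + (r + s) ≡ p + r + (s + q)
    eq′ = solve-∀
    IH : β r (P * u + y) + suc ℓ ≤ β r (P * u) + (R a ℓ + P)
    IH = subst (λ t → β r (t * u + y) + suc ℓ ≤ β r (t * u) + (R a ℓ + t)) a^ℓ
           (β-below-carry ℓ u y ℓ<r (sym a^ℓ))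
    H/a : P * u ≡ H / a
    H/a = sym (trans (cong (_/ a) (*-assoc a P u)) (m*k/m (P * u)))
    eq″ : ∀ b y u → (1 + b) * (1 + y) * u + ((1 + b) * y + b) ≡ (1 + b) * ((1 + y) * u + y) + b
    eq″ = solve-∀
    x≡ : x ≡ a * y + b
    x≡ = suc-injective (trans 1+x≡ (e b y))
      where
      e : ∀ b y → (1 + b) * (1 + y) ≡ suc ((1 + b) * y + b)
      e = solve-∀
    /a : (H + x) / a ≡ P * u + y
    /a = trans (cong (_/ a) (trans (cong (λ t → H + t) x≡) (eq″ b y u))) ([ak+b]/a (P * u + y))

  -- A truncated geometric series. It makes the subtraction in `κ` exact and excludes a nonempty sum
  -- of zero repunits in `V-peel`.
  b*β≤a* : ∀ r h → b * β r h ≤ a * h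
  b*β≤a* zero    h = subst (_≤ a * h) (sym (*-zeroʳ b)) z≤n
  b*β≤a* (suc r) h = begin
    b * (h + β r (h / a))     ≡⟨ *-distribˡ-+ b h _ ⟩
    b * h + b * β r (h / a)   ≤⟨ +-monoʳ-≤ (b * h) (b*β≤a* r (h / a)) ⟩
    b * h + a * (h / a)       ≡⟨ cong (λ t → b * h + t) (*-comm a (h / a)) ⟩
    b * h + h / a * a         ≤⟨ +-monoʳ-≤ (b * h) (m/n*n≤m h a) ⟩
    b * h + h                 ≡⟨ +-comm (b * h) h ⟩
    a * h                     ∎
    where open ≤-Reasoning

  β-≤-suc : ∀ r h → β r h ≤ β (suc r) h
  β-≤-suc zero    h = z≤n
  β-≤-suc (suc r) h = +-monoʳ-≤ h (β-≤-suc r (h / a))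

  β-suc-≡ : ∀ r {h} → h < a ^ r → β (suc r) h ≡ β r h
  β-suc-≡ zero    {zero}  _ = refl
  β-suc-≡ zero    {suc _} (s≤s ())
  β-suc-≡ (suc r) {h}    h<a^ =
    cong (λ t → h + t) (β-suc-≡ r (m<n*o⇒m/o<n (subst (h <_) (*-comm a (a ^ r)) h<a^)))

  β-<a^ : ∀ r {h} → h < a ^ r → β r h < R a (suc r)
  β-<a^ r {h} h<a^ = begin-strict
    β r h             ≤⟨ β-mono r (<⇒≤ h<a^) ⟩
    β r (a ^ r)       <⟨ m<m+n _ z<s ⟩
    β r (a ^ r) + 1   ≡⟨ β-a^ r ⟩
    R a (suc r)       ∎
    where open ≤-Reasoning

  β-peel : ∀ r {h q} → q ≤ β r h → 0 < q →
    ∃[ i ] ∃[ x ] ∃[ h′ ] i < r × q ≡ R a (suc i) + x × a ^ i + h′ ≤ h × x ≤ β r h′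
  β-peel zero    z≤n ()
  β-peel (suc r) {h} {q} q≤ 0<q with R a (suc r) ≤? q | a ^ r ≤? h
  ... | yes R≤q | yes a^≤h =
    r , q ∸ R a (suc r) , h ∸ a ^ r , ≤-refl , sym (m+[n∸m]≡n R≤q) , ≤-reflexive (m+[n∸m]≡n a^≤h) ,
    (begin
      q ∸ R a (suc r)                                     ≤⟨ ∸-monoˡ-≤ (R a (suc r)) q≤ ⟩
      β (suc r) h ∸ R a (suc r)
        ≡⟨ cong (λ t → β (suc r) t ∸ R a (suc r)) (m∸n+n≡m a^≤h) ⟨
      β (suc r) (h ∸ a ^ r + a ^ r) ∸ R a (suc r)         ≡⟨ cong (_∸ R a (suc r)) (β-+^-top r (h ∸ a ^ r)) ⟩
      β (suc r) (h ∸ a ^ r) + R a (suc r) ∸ R a (suc r)   ≡⟨ m+n∸n≡m _ (R a (suc r)) ⟩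
      β (suc r) (h ∸ a ^ r)                               ∎)
    where open ≤-Reasoning
  ... | yes R≤q | no a^≰h = contradiction R≤q (<⇒≱ (≤-<-trans q≤
    (subst (_< R a (suc r)) (sym (β-suc-≡ r (≰⇒> a^≰h))) (β-<a^ r (≰⇒> a^≰h)))))
  ... | no R≰q | yes a^≤h
    -- As `q < R a (suc r)` and `β r (a ^ r) + 1 ≡ R a (suc r)`, the value `a ^ r ≤ h` already
    -- suffices in place of `h`.
    with i , x , h′ , i<r , q≡ , h′≤ , x≤ ←
           β-peel r (s≤s⁻¹ (subst (q <_) (trans (sym (β-a^ r)) (+-comm _ 1)) (≰⇒> R≰q))) 0<q
    = i , x , h′ , m<n⇒m<1+n i<r , q≡ , ≤-trans h′≤ a^≤h , ≤-trans x≤ (β-≤-suc r h′)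
  ... | no _ | no a^≰h
    with i , x , h′ , i<r , q≡ , h′≤ , x≤ ← β-peel r (subst (q ≤_) (β-suc-≡ r (≰⇒> a^≰h)) q≤) 0<q
    = i , x , h′ , m<n⇒m<1+n i<r , q≡ , h′≤ , ≤-trans x≤ (β-≤-suc r h′)

  suc-/ : ∀ h → (suc h / a ≡ h / a) ⊎ (suc h ≡ a * suc (h / a))
  suc-/ h with m≤n⇒m<n∨m≡n (m%n<n h a)
  ... | inj₁ 1+h%a<a = inj₁ (begin
    suc h / a                             ≡⟨ cong (λ t → suc t / a) (m≡m%n+[m/n]*n h a) ⟩
    (suc (h % a) + h / a * a) / a         ≡⟨ +-distrib-/-∣ʳ (suc (h % a)) (n∣m*n (h / a)) ⟩
    suc (h % a) / a + h / a * a / a       ≡⟨ cong₂ _+_ (m<n⇒m/n≡0 1+h%a<a) (m*n/n≡m (h / a) a) ⟩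
    h / a                                 ∎)
    where open ≡-Reasoning
  ... | inj₂ 1+h%a≡a = inj₂ (begin
    suc h                     ≡⟨ cong suc (m≡m%n+[m/n]*n h a) ⟩
    suc (h % a) + h / a * a   ≡⟨ cong (_+ h / a * a) 1+h%a≡a ⟩
    a + h / a * a             ≡⟨ *-comm (suc (h / a)) a ⟩
    a * suc (h / a)           ∎)
    where open ≡-Reasoning

  -- Passing to `suc h` raises by one exactly the quotients by those `a ^ i` that divide `suc h`,
  -- and these `i` form an initial segment.
  β-jump : ∀ r {h} ℓ → β r h + ℓ < β r (suc h) → ℓ < r × a ^ ℓ ∣ suc h
  β-jump (suc r) zero    _ = z<s , 1∣ _
  β-jump (suc r) {h} (suc ℓ) jump with suc-/ h
  ... | inj₁ eq = contradiction jump (≤⇒≯ (begin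
    suc (h + β r (suc h / a))     ≡⟨ cong (λ t → suc (h + β r t)) eq ⟩
    suc (h + β r (h / a))         ≤⟨ s≤s (m≤m+n _ ℓ) ⟩
    suc (h + β r (h / a) + ℓ)     ≡⟨ +-suc _ ℓ ⟨
    h + β r (h / a) + suc ℓ       ∎))
    where open ≤-Reasoning
  ... | inj₂ eq with β-jump r {h / a} ℓ (+-cancelˡ-< h _ _ (s≤s⁻¹ (begin
    suc (suc (h + (β r (h / a) + ℓ)))   ≡⟨ cong suc (e h _ ℓ) ⟩
    suc (h + β r (h / a) + suc ℓ)       ≤⟨ jump ⟩
    suc h + β r (suc h / a)
      ≡⟨ cong (λ t → suc h + β r t) (trans (cong (_/ a) eq) (m*k/m (suc (h / a)))) ⟩
    suc h + β r (suc (h / a))           ∎)))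
    where
    open ≤-Reasoning
    e : ∀ x y z → suc (x + (y + z)) ≡ x + y + suc z
    e = solve-∀
  ...   | ℓ<r , a^∣ = s≤s ℓ<r , subst (a ^ suc ℓ ∣_) (sym eq) (*-monoʳ-∣ a a^∣)

-- Maxima, multiples and residues modulo `M`.

argmax : ∀ (f : ℕ → ℕ) n → 0 < n → ∃[ i ] i < n × (∀ {j} → j < n → f j ≤ f i)
argmax f (suc zero) _ = 0 , z<s , λ { z<s → ≤-refl }
argmax f (suc n@(suc _)) _ with argmax f n z<s
... | i , i<n , max with f n ≤? f i
...   | yes fn≤fi = i , m<n⇒m<1+n i<n , bound
  where
  bound : ∀ {j} → j < suc n → f j ≤ f i
  bound j<1+n with m≤n⇒m<n∨m≡n (s≤s⁻¹ j<1+n)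
  ... | inj₁ j<n  = max j<n
  ... | inj₂ refl = fn≤fi
...   | no fn≰fi = n , ≤-refl , bound
  where
  bound : ∀ {j} → j < suc n → f j ≤ f n
  bound j<1+n with m≤n⇒m<n∨m≡n (s≤s⁻¹ j<1+n)
  ... | inj₁ j<n  = ≤-trans (max j<n) (<⇒≤ (≰⇒> fn≰fi))
  ... | inj₂ refl = ≤-refl

multiple∈ : ∀ {A : Pred ℕ 0ℓ} k {x} → x ∈ ⟨ A ⟩ → k * x ∈ ⟨ A ⟩
multiple∈ zero    x∈ = 0∈
multiple∈ (suc k) x∈ = add x∈ (multiple∈ k x∈)

-- Congruence modulo `M` is expressed by multiples of `M` on both sides, which avoids subtraction.
-- Bézout supplies an inverse of `B`.
residue : ∀ {M B} → 0 < M → Coprime M B → ∀ N →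
  ∃[ q ] q < M × ∃[ x ] ∃[ y ] N + x * M ≡ B * q + y * M
residue {M@(suc m)} {B} _ M⊥B N = solve (coprime-Bézout M⊥B)
  where
  open ≡-Reasoning
  reduce : ∀ n x y → N + x * M ≡ B * n + y * M →
    ∃[ q ] q < M × ∃[ x ] ∃[ y ] N + x * M ≡ B * q + y * M
  reduce n x y eq = n % M , m%n<n n M , x , B * (n / M) + y , (begin
    N + x * M                             ≡⟨ eq ⟩
    B * n + y * M                         ≡⟨ cong (λ t → B * t + y * M) (m≡m%n+[m/n]*n n M) ⟩
    B * (n % M + n / M * M) + y * M       ≡⟨ e B (n % M) (n / M) M y ⟩
    B * (n % M) + (B * (n / M) + y) * M   ∎)
    where
    e : ∀ p q r s t → p * (q + r * s) + t * s ≡ p * q + (p * r + t) * s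
    e = solve-∀
  solve : Bézout.Identity 1 M B → _
  solve (Bézout.-+ x y eq) = reduce (N * y) (N * x) 0 (begin
    N + N * x * M     ≡⟨ e N x M ⟩
    N * (1 + x * M)   ≡⟨ cong (N *_) eq ⟩
    N * (y * B)       ≡⟨ e′ N y B M ⟩
    B * (N * y) + 0 * M ∎)
    where
    e : ∀ p q r → p + p * q * r ≡ p * (1 + q * r)
    e = solve-∀
    e′ : ∀ p q r s → p * (q * r) ≡ r * (p * q) + 0 * s
    e′ = solve-∀
  -- Here `y * B` is -1 modulo `M`; the factor `m`, also -1, corrects the sign.
  solve (Bézout.+- x y eq) = reduce (N * m * y) (N * x * m) N (begin
    N + N * x * m * M               ≡⟨ e N x m M ⟩
    N + N * m * (x * M)             ≡⟨ cong (λ t → N + N * m * t) eq ⟨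
    N + N * m * (1 + y * B)         ≡⟨ e′ N m y B ⟩
    B * (N * m * y) + N * M         ∎)
    where
    e : ∀ p q r s → p + p * q * r * s ≡ p + p * r * (q * s)
    e = solve-∀
    e′ : ∀ p q r s → p + p * q * (1 + r * s) ≡ s * (p * q * r) + p * (1 + q)
    e′ = solve-∀

-- Otherwise `M` divides `B * (q′ ∸ q)`, hence `q′ ∸ q`, which lies strictly between 0 and `M`.
*-distinct-mod : ∀ {M B q q′} x y → Coprime M B → q < q′ → q′ < M →
  ¬ B * q + x * M ≡ B * q′ + y * M
*-distinct-mod {M} {B} {q} {q′} x y M⊥B q<q′ q′<M eq =
  >⇒∤ ⦃ >-nonZero (m<n⇒0<n∸m q<q′) ⦄ (≤-<-trans (m∸n≤m q′ q) q′<M)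
    (coprime-divisor M⊥B (∣m+n∣m⇒∣n (subst (M ∣_) x*M≡ (n∣m*n x)) (n∣m*n y)))
  where
  open ≡-Reasoning
  e : ∀ p q r s → p * (q + r) + s ≡ p * q + (s + p * r)
  e = solve-∀
  x*M≡ : x * M ≡ y * M + B * (q′ ∸ q)
  x*M≡ = +-cancelˡ-≡ (B * q) _ _ (begin
    B * q + x * M                   ≡⟨ eq ⟩
    B * q′ + y * M                  ≡⟨ cong (λ t → B * t + y * M) (m+[n∸m]≡n (<⇒≤ q<q′)) ⟨
    B * (q + (q′ ∸ q)) + y * M      ≡⟨ e B q (q′ ∸ q) (y * M) ⟩
    B * q + (y * M + B * (q′ ∸ q))  ∎)

*-cancel-mod : ∀ {M B q q′} x y → Coprime M B → q < M → q′ < M →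
  B * q + x * M ≡ B * q′ + y * M → q ≡ q′
*-cancel-mod {q = q} {q′} x y M⊥B q<M q′<M eq with <-cmp q q′
... | tri< q<q′ _ _ = contradiction eq (*-distinct-mod x y M⊥B q<q′ q′<M)
... | tri≈ _ q≡q′ _ = q≡q′
... | tri> _ _ q′<q = contradiction (sym eq) (*-distinct-mod y x M⊥B q′<q q<M)

G : (a M B : ℕ) → Pred ℕ 0ℓ
G a M B x = ∃[ j ] x ≡ M + B * R a j

M∈⟨G⟩ : ∀ a M B → M ∈ ⟨ G a M B ⟩
M∈⟨G⟩ a M B = gen (0 , sym (trans (cong (λ t → M + t) (*-zeroʳ B)) (+-identityʳ M)))

-- Sums of repunits with the least number of terms.

module Inverse (b r′ : ℕ) where

  open Repunit b

  -- In the application `r` is `m - 1`. Being a successor makes `β r` strictly increasing.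
  r : ℕ
  r = suc r′

  h≤βh : ∀ h → h ≤ β r h
  h≤βh h = m≤m+n h _

  β-<-suc : ∀ h → β r h < β r (suc h)
  β-<-suc h = s≤s (+-monoʳ-≤ h (β-mono r′ (/-monoˡ-≤ a (n≤1+n h))))

  β-cancel-< : ∀ {x y} → β r x < β r y → x < y
  β-cancel-< βx<βy = ≰⇒> (λ y≤x → <⇒≱ βx<βy (β-mono r y≤x))

  -- η q is the least h with q ≤ β r h
  η : ℕ → ℕ
  η zero = zero
  η (suc q) with suc q ≤? β r (η q)
  ... | yes _ = η q
  ... | no  _ = suc (η q)

  q≤βη : ∀ q → q ≤ β r (η q)
  q≤βη zero = z≤n
  q≤βη (suc q) with suc q ≤? β r (η q)
  ... | yes q<β = q<β
  -- Strict growth of `β r` makes a single increment of `η q` enough.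
  ... | no  _   = ≤-<-trans (q≤βη q) (β-<-suc (η q))

  η-least : ∀ q {h} → q ≤ β r h → η q ≤ h
  η-least zero    _ = z≤n
  η-least (suc q) q<β with suc q ≤? β r (η q)
  ... | yes _  = η-least q (<⇒≤ q<β)
  ... | no  ≰β = ≤∧≢⇒< (η-least q (<⇒≤ q<β)) (λ { refl → ≰β q<β })

  ℓ : ℕ → ℕ
  ℓ q = β r (η q) ∸ q

  q+ℓ : ∀ q → q + ℓ q ≡ β r (η q)
  q+ℓ q = m+[n∸m]≡n (q≤βη q)

  -- As `η q` is least, `β r` is still below `q` one step earlier, so its last step exceeds `ℓ q`
  -- and `β-jump` applies. If `η q` is 0, then so is `ℓ q`.
  ℓ-spec : ∀ q → ℓ q < r × a ^ ℓ q ∣ η q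
  ℓ-spec q with η q in ηq | q+ℓ q | (λ h → η-least q {h})
  ... | zero  | q+ℓ≡ | _ rewrite β-zero r′ | 0∸n≡0 q = z<s , 1 ∣0
  ... | suc h | q+ℓ≡ | least = β-jump r _ (begin-strict
      β r h + ℓ′   <⟨ +-monoˡ-< ℓ′ (≰⇒> (λ q≤ → 1+n≰n (least h q≤))) ⟩
      q + ℓ′       ≡⟨ q+ℓ≡ ⟩
      β r (suc h)  ∎)
    where
    open ≤-Reasoning
    ℓ′ = β r (suc h) ∸ q

  -- Since `a ^ ℓ q` divides `η q`, `β-below-carry` bounds `β r` at `η q + a ^ ℓ q - 1` by
  -- `β r (η q) + R a (suc (ℓ q)) - suc (ℓ q)`, one less than the required `q + R a (suc (ℓ q))`.
  η-step : ∀ q → η q + a ^ ℓ q ≤ η (q + R a (suc (ℓ q)))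
  η-step q with ℓ-spec q
  ... | ℓ<r , divides u ηq≡ = ≮⇒≥ λ η< → 1+n≰n (begin
    suc (q + R a (suc (ℓ q)) + ℓ q)                   ≡⟨ +-suc (q + R a (suc (ℓ q))) (ℓ q) ⟨
    q + R a (suc (ℓ q)) + suc (ℓ q)                   ≤⟨ +-monoˡ-≤ (suc (ℓ q)) (q≤βη (q + R a (suc (ℓ q)))) ⟩
    β r (η (q + R a (suc (ℓ q)))) + suc (ℓ q)
      ≤⟨ +-monoˡ-≤ (suc (ℓ q)) (β-mono r (s≤s⁻¹ (≤-trans η< (≤-reflexive η+a^≡)))) ⟩
    β r (η q + x) + suc (ℓ q)                         ≡⟨ cong (λ t → β r (t + x) + suc (ℓ q)) ηq≡′ ⟩
    β r (a ^ ℓ q * u + x) + suc (ℓ q)                 ≤⟨ β-below-carry (ℓ q) u x ℓ<r 1+x≡ ⟩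
    β r (a ^ ℓ q * u) + R a (suc (ℓ q))               ≡⟨ cong (λ t → β r t + R a (suc (ℓ q))) ηq≡′ ⟨
    β r (η q) + R a (suc (ℓ q))                       ≡⟨ cong (_+ R a (suc (ℓ q))) (q+ℓ q) ⟨
    q + ℓ q + R a (suc (ℓ q))                         ≡⟨ e q (ℓ q) _ ⟩
    q + R a (suc (ℓ q)) + ℓ q                         ∎)
    where
    open ≤-Reasoning
    e : ∀ x y z → x + y + z ≡ x + z + y
    e = solve-∀
    x = a ^ ℓ q ∸ 1
    1+x≡ : suc x ≡ a ^ ℓ q
    1+x≡ = m+[n∸m]≡n (0<a^ (ℓ q))
    η+a^≡ : η q + a ^ ℓ q ≡ suc (η q + x)
    η+a^≡ = trans (cong (λ t → η q + t) (sym 1+x≡)) (+-suc (η q) x)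
    ηq≡′ : η q ≡ a ^ ℓ q * u
    ηq≡′ = trans ηq≡ (*-comm u (a ^ ℓ q))

  -- Both `η p` and `η p′` are multiples of `a ^ ℓ p`, and they are distinct, so they differ by at
  -- least `a ^ ℓ p`. Applying `β r` and removing the common overshoot gives the distance.
  ℓ-spacing : ∀ {p p′} → ℓ p ≡ ℓ p′ → p < p′ → p + R a (suc (ℓ p)) ≤ p′
  ℓ-spacing {p} {p′} ℓ≡ p<p′ with ℓ-spec p | ℓ-spec p′
  ... | ℓ<r , divides u ηp≡ | _ , divides u′ ηp′≡ = +-cancelʳ-≤ (ℓ p) _ _ (begin
    p + R a (suc (ℓ p)) + ℓ p     ≡⟨ e p _ (ℓ p) ⟩
    p + ℓ p + R a (suc (ℓ p))     ≡⟨ cong (_+ R a (suc (ℓ p))) (q+ℓ p) ⟩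
    β r (η p) + R a (suc (ℓ p))   ≤⟨ β-+^-≥ (ℓ p) (η p) ℓ<r ⟩
    β r (η p + a ^ ℓ p)           ≤⟨ β-mono r gap ⟩
    β r (η p′)                    ≡⟨ q+ℓ p′ ⟨
    p′ + ℓ p′                     ≡⟨ cong (λ t → p′ + t) ℓ≡ ⟨
    p′ + ℓ p                      ∎)
    where
    open ≤-Reasoning
    e : ∀ x y z → x + y + z ≡ x + z + y
    e = solve-∀
    ηp′≡′ : η p′ ≡ u′ * a ^ ℓ p
    ηp′≡′ = trans ηp′≡ (cong (λ t → u′ * a ^ t) (sym ℓ≡))
    ηp<ηp′ : η p < η p′
    ηp<ηp′ = β-cancel-< (subst₂ _<_ (q+ℓ p) (trans (cong (λ t → p′ + t) ℓ≡) (q+ℓ p′)) (+-monoˡ-< (ℓ p) p<p′))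
    gap : η p + a ^ ℓ p ≤ η p′
    gap = begin
      η p + a ^ ℓ p           ≡⟨ +-comm (η p) _ ⟩
      a ^ ℓ p + η p           ≡⟨ cong (λ t → a ^ ℓ p + t) ηp≡ ⟩
      suc u * a ^ ℓ p
        ≤⟨ *-monoˡ-≤ (a ^ ℓ p) (*-cancelʳ-< (a ^ ℓ p) u u′ (subst₂ _<_ ηp≡ ηp′≡′ ηp<ηp′)) ⟩
      u′ * a ^ ℓ p            ≡⟨ ηp′≡′ ⟨
      η p′                    ∎

  -- κ q is the least number of repunits among R 1, …, R r with sum q
  κ : ℕ → ℕ
  κ q = a * η q ∸ b * q

  b*q+κ : ∀ q → b * q + κ q ≡ a * η q
  b*q+κ q = m+[n∸m]≡n (≤-trans (*-monoʳ-≤ b (q≤βη q)) (b*β≤a* r (η q)))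

  -- In `a * η - b * q` the first term grows by at least `a * a ^ ℓ q` and the second by
  -- `b * R a (suc (ℓ q))`, which is one less than that.
  κ-step : ∀ q → suc (κ q) ≤ κ (q + R a (suc (ℓ q)))
  κ-step q = +-cancelˡ-≤ (b * q + b * Rℓ) _ _ (begin
    b * q + b * Rℓ + suc (κ q)         ≡⟨ e (b * q) (b * Rℓ) (κ q) ⟩
    b * q + κ q + (b * Rℓ + 1)         ≡⟨ cong₂ _+_ (b*q+κ q) (b*R+1 (suc (ℓ q))) ⟩
    a * η q + a * a ^ ℓ q              ≡⟨ *-distribˡ-+ a (η q) _ ⟨
    a * (η q + a ^ ℓ q)                ≤⟨ *-monoʳ-≤ a (η-step q) ⟩
    a * η (q + Rℓ)                     ≡⟨ b*q+κ (q + Rℓ) ⟨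
    b * (q + Rℓ) + κ (q + Rℓ)          ≡⟨ cong (_+ κ (q + Rℓ)) (*-distribˡ-+ b q Rℓ) ⟩
    b * q + b * Rℓ + κ (q + Rℓ)        ∎)
    where
    open ≤-Reasoning
    Rℓ = R a (suc (ℓ q))
    e : ∀ x y z → x + y + suc z ≡ x + z + (y + 1)
    e = solve-∀

  -- q is a sum of at most k repunits among R 1, …, R r
  V : ℕ → ℕ → Set
  V q k = ∃[ h ] q ≤ β r h × a * h ≤ b * q + k

  V⇒κ≤ : ∀ {q k} → V q k → κ q ≤ k
  V⇒κ≤ {q} {k} (h , q≤ , ah≤) =
    m≤n+o⇒m∸n≤o (a * η q) (b * q) (≤-trans (*-monoʳ-≤ a (η-least q q≤)) ah≤)

  κ≤⇒V : ∀ {q k} → κ q ≤ k → V q k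
  κ≤⇒V {q} κ≤k = η q , q≤βη q , ≤-trans (≤-reflexive (sym (b*q+κ q))) (+-monoʳ-≤ (b * q) κ≤k)

  V-+ : ∀ {q k q′ k′} → V q k → V q′ k′ → V (q + q′) (k + k′)
  V-+ {q} {k} {q′} {k′} (h , q≤ , ah≤) (h′ , q′≤ , ah′≤) =
    h + h′ , ≤-trans (+-mono-≤ q≤ q′≤) (β-superadditive r h h′) , (begin
      a * (h + h′)              ≡⟨ *-distribˡ-+ a h h′ ⟩
      a * h + a * h′            ≤⟨ +-mono-≤ ah≤ ah′≤ ⟩
      b * q + k + (b * q′ + k′) ≡⟨ e b q k q′ k′ ⟩
      b * (q + q′) + (k + k′)   ∎)
    where
    open ≤-Reasoning
    e : ∀ b q k q′ k′ → b * q + k + (b * q′ + k′) ≡ b * (q + q′) + (k + k′)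
    e = solve-∀

  -- A repunit `R a (suc i)` accounts for `a ^ i` in `h`, and `a * a ^ i` exceeds `b * R a (suc i)`
  -- by 1; so `a * h - b * q` counts the repunits, and removing one lowers `k` by one.
  V-peel : ∀ {q k} → V q k → 0 < q →
    ∃[ i ] ∃[ x ] ∃[ k′ ] i < r × q ≡ R a (suc i) + x × k ≡ suc k′ × V x k′
  V-peel {q} {k} (h , q≤ , ah≤) 0<q with β-peel r q≤ 0<q
  ... | i , x , h′ , i<r , refl , ≤h , x≤ = split k bound
    where
    open ≤-Reasoning
    e : ∀ b y x k → b * (y + x) + k + 1 ≡ (b * y + 1) + (b * x + k)
    e = solve-∀
    bound : suc (a * h′) ≤ b * x + k
    bound = +-cancelˡ-≤ (a ^ suc i) _ _ (begin
      a ^ suc i + suc (a * h′)               ≡⟨ +-suc (a ^ suc i) _ ⟩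
      suc (a ^ suc i + a * h′)               ≡⟨ cong suc (*-distribˡ-+ a (a ^ i) h′) ⟨
      suc (a * (a ^ i + h′))                 ≤⟨ s≤s (*-monoʳ-≤ a ≤h) ⟩
      suc (a * h)                            ≤⟨ s≤s ah≤ ⟩
      suc (b * (R a (suc i) + x) + k)        ≡⟨ +-comm 1 _ ⟩
      b * (R a (suc i) + x) + k + 1          ≡⟨ e b _ x k ⟩
      (b * R a (suc i) + 1) + (b * x + k)    ≡⟨ cong (_+ (b * x + k)) (b*R+1 (suc i)) ⟩
      a ^ suc i + (b * x + k)                ∎)
    split : ∀ k → suc (a * h′) ≤ b * x + k →
      ∃[ i′ ] ∃[ x′ ] ∃[ k′ ] i′ < r × R a (suc i) + x ≡ R a (suc i′) + x′ × k ≡ suc k′ × V x′ k′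
    -- For `k` zero the bound would give `a * h′ < b * x`, against `b * x ≤ b * β r h′ ≤ a * h′`.
    split zero bd = contradiction (≤-trans (*-monoʳ-≤ b x≤) (b*β≤a* r h′))
      (<⇒≱ (subst (suc (a * h′) ≤_) (+-identityʳ (b * x)) bd))
    split (suc k′) bd =
      i , x , k′ , i<r , refl , refl , h′ , x≤ , s≤s⁻¹ (subst (suc (a * h′) ≤_) (+-suc (b * x) k′) bd)

  κ-pos : ∀ {q} → 0 < q → 0 < κ q
  κ-pos {q} 0<q with V-peel (κ≤⇒V {q} ≤-refl) 0<q
  ... | _ , _ , _ , _ , _ , κ≡ , _ = subst (0 <_) (sym κ≡) z<s

  V-repunit : ∀ {i} → i < r → V (R a (suc i)) 1
  V-repunit {i} i<r = a ^ i ,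
    subst (λ t → t + R a (suc i) ≤ β r (a ^ i)) (β-zero r) (β-+^-≥ i 0 i<r) ,
    ≤-reflexive (sym (b*R+1 (suc i)))

  V-0 : ∀ {k} → V 0 k
  V-0 = 0 , z≤n , ≤-trans (≤-reflexive (*-zeroʳ a)) z≤n

  -- The semigroup and its Apéry set.

  module Semigroup (M B : ℕ) (2≤M : 2 ≤ M) (M⊥B : Coprime M B)
    (M≤R : M ≤ R a (suc r)) (R≤M+B : R a (suc r) ≤ M + B) where

    S : Pred ℕ 0ℓ
    S = ⟨ G a M B ⟩

    0<M : 0 < M
    0<M = <-trans z<s 2≤M

    e₀ : ℕ
    e₀ = R a (suc r) ∸ M

    M+e₀ : M + e₀ ≡ R a (suc r)
    M+e₀ = m+[n∸m]≡n M≤R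

    e₀≤B : e₀ ≤ B
    e₀≤B = m≤n+o⇒m∸n≤o (R a (suc r)) M R≤M+B

    -- This accompanies `k * M + B * (q + M) ≡ (k + B) * M + B * q`. Adding `e₀` copies of `R a
    -- 1` completes `M` to `R a (suc r)`; then `a ^ r` is taken from `h`, which lowers `β
    -- r` by less than `R a (suc r)`. The count grows by at most `e₀ ≤ B`.
    V-reduce : ∀ {q k} → V (q + M) k → V q (k + B)
    V-reduce {q} {k} (h , q+M≤ , ah≤) = h₀ ,
      +-cancelʳ-≤ (R a (suc r)) _ _ (begin
        q + R a (suc r)             ≤⟨ q+R≤ ⟩
        β r (h + e₀)                ≤⟨ m≤m+n _ 1 ⟩
        β r (h + e₀) + 1            ≡⟨ cong (λ t → β r t + 1) (m∸n+n≡m a^≤) ⟨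
        β r (h₀ + a ^ r) + 1        ≡⟨ β-+^-above r h₀ ⟩
        β r h₀ + R a (suc r)        ∎) ,
      +-cancelʳ-≤ (a ^ suc r) _ _ (begin
        a * h₀ + a * a ^ r                 ≡⟨ *-distribˡ-+ a h₀ _ ⟨
        a * (h₀ + a ^ r)                   ≡⟨ cong (a *_) (m∸n+n≡m a^≤) ⟩
        a * (h + e₀)                       ≡⟨ *-distribˡ-+ a h e₀ ⟩
        a * h + a * e₀                     ≤⟨ +-monoˡ-≤ (a * e₀) ah≤ ⟩
        b * (q + M) + k + a * e₀           ≡⟨ e b q M k e₀ ⟩
        b * q + (k + e₀) + b * (M + e₀)    ≤⟨ +-mono-≤ (+-monoʳ-≤ (b * q) (+-monoʳ-≤ k e₀≤B)) (m≤m+n _ 1) ⟩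
        b * q + (k + B) + (b * (M + e₀) + 1)   ≡⟨ cong (λ t → b * q + (k + B) + (b * t + 1)) M+e₀ ⟩
        b * q + (k + B) + (b * R a (suc r) + 1) ≡⟨ cong (λ t → b * q + (k + B) + t) (b*R+1 (suc r)) ⟩
        b * q + (k + B) + a ^ suc r        ∎)
      where
      open ≤-Reasoning
      e : ∀ b q M k x → b * (q + M) + k + (1 + b) * x ≡ b * q + (k + x) + b * (M + x)
      e = solve-∀
      q+R≤ : q + R a (suc r) ≤ β r (h + e₀)
      q+R≤ = begin
        q + R a (suc r)     ≡⟨ cong (λ t → q + t) M+e₀ ⟨
        q + (M + e₀)        ≡⟨ +-assoc q M e₀ ⟨
        q + M + e₀          ≤⟨ +-mono-≤ q+M≤ (h≤βh e₀) ⟩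
        β r h + β r e₀      ≤⟨ β-superadditive r h e₀ ⟩
        β r (h + e₀)        ∎
      a^≤ : a ^ r ≤ h + e₀
      -- Below `a ^ r` the value of `β r` would not reach `R a (suc r)`.
      a^≤ = ≮⇒≥ (λ < → <⇒≱ (β-<a^ r <) (≤-trans (m≤n+m _ q) q+R≤))
      h₀ = h + e₀ ∸ a ^ r

    V-reduce* : ∀ v {q k} → V (q + v * M) k → V q (k + v * B)
    V-reduce* zero    {q} {k} V₀ = subst₂ V (+-identityʳ q) (sym (+-identityʳ k)) V₀
    V-reduce* (suc v) {q} {k} V₀ = subst (V q) (e k B (v * B))
      (V-reduce* v (V-reduce (subst (λ t → V t k) (e′ q M (v * M)) V₀)))
      where
      e : ∀ x y z → x + y + z ≡ x + (y + z)
      e = solve-∀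
      e′ : ∀ x y z → x + (y + z) ≡ x + z + y
      e′ = solve-∀

    -- The explicit form of `S`. Of the `k` copies of `M`, each repunit in `q` uses one; the others
    -- stand for the generator `M` itself.
    T : Pred ℕ 0ℓ
    T N = ∃[ k ] ∃[ q ] N ≡ k * M + B * q × V q k

    T-+ : ∀ {x y} → T x → T y → T (x + y)
    T-+ (k , q , refl , Vq) (k′ , q′ , refl , Vq′) =
      k + k′ , q + q′ , e k M B q k′ q′ , V-+ Vq Vq′
      where
      e : ∀ k M B q k′ q′ → k * M + B * q + (k′ * M + B * q′) ≡ (k + k′) * M + B * (q + q′)
      e = solve-∀

    T-* : ∀ n {x} → T x → T (n * x)
    T-* zero    Tx = 0 , 0 , sym (*-zeroʳ B) , V-0
    T-* (suc n) Tx = T-+ Tx (T-* n Tx)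

    T-peel : ∀ {N} → T N → 0 < N → ∃[ i ] ∃[ y ] i ≤ r × N ≡ M + B * R a i + y × T y
    T-peel (zero , zero , refl , V₀) 0<N = contradiction (*-zeroʳ B) (>⇒≢ 0<N)
    -- With `q` exhausted, the generator split off is `M`, the one with `i` equal to 0.
    T-peel (suc k , zero , refl , V₀) _ =
      0 , k * M , z≤n , e M B (k * M) , k , 0 ,
      sym (trans (cong (λ t → k * M + t) (*-zeroʳ B)) (+-identityʳ _)) , V-0
      where
      e : ∀ x y z → x + z + y * 0 ≡ x + y * 0 + z
      e = solve-∀
    T-peel (k , q@(suc _) , refl , Vq) _ with V-peel Vq z<s
    ... | i , x , k′ , i<r , q≡ , refl , Vx =
      suc i , k′ * M + B * x , i<r ,
      trans (cong (λ t → suc k′ * M + B * t) q≡) (e M k′ B _ x) , k′ , x , refl , Vx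
      where
      e : ∀ M k B y x → (1 + k) * M + B * (y + x) ≡ M + B * y + (k * M + B * x)
      e = solve-∀

    T-small : ∀ {j} → j ≤ suc r → T (M + B * R a j)
    T-small {zero} _ = 1 , 0 , cong (_+ B * 0) (sym (*-identityˡ M)) , V-0
    T-small {suc i} 1+i≤1+r with m≤n⇒m<n∨m≡n (s≤s⁻¹ 1+i≤1+r)
    ... | inj₁ i<r  = 1 , R a (suc i) , cong (_+ B * R a (suc i)) (sym (*-identityˡ M)) , V-repunit i<r
    -- From `R a (suc r) ≡ M + e₀` this generator is `suc B * M + B * e₀`, and `e₀ ≤ B` copies of
    -- `R a 1` represent `e₀`; hence it is redundant.
    ... | inj₂ refl = suc B , e₀ , trans (cong (λ t → M + B * t) (sym M+e₀)) (e M B e₀) ,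
      e₀ , h≤βh e₀ , (begin
        a * e₀         ≡⟨ +-comm e₀ (b * e₀) ⟩
        b * e₀ + e₀    ≤⟨ +-monoʳ-≤ (b * e₀) (m≤n⇒m≤1+n e₀≤B) ⟩
        b * e₀ + suc B ∎)
      where
      open ≤-Reasoning
      e : ∀ M B x → M + B * (M + x) ≡ (1 + B) * M + B * x
      e = solve-∀

    -- Writing s_j = M + B R_j, the relation s_{j+1} + a s_i = a s_j + s_{i+1} gives
    -- s_{j+1} = a y + s_{i+1} whenever s_j = s_i + y.
    T-gen : ∀ j → T (M + B * R a j)
    T-gen zero    = T-small z≤n
    T-gen (suc j) with T-peel (T-gen j) (<-≤-trans 0<M (m≤m+n M _))
    ... | i , y , i≤r , eq , Ty = subst T (sym (begin
      M + B * R a (suc j)         ≡⟨ cong (λ t → M + B * t) (R-suc j) ⟩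
      M + B * (1 + a * R a j)     ≡⟨ e M B a (R a j) ⟩
      M + B + a * (B * R a j)
        ≡⟨ cong (λ t → M + B + a * t) (+-cancelˡ-≡ M _ _ (trans eq (+-assoc M _ y))) ⟩
      M + B + a * (B * R a i + y) ≡⟨ e′ M B a (R a i) y ⟩
      M + B * (1 + a * R a i) + a * y ≡⟨ cong (λ t → M + B * t + a * y) (R-suc i) ⟨
      M + B * R a (suc i) + a * y ∎)) (T-+ (T-small (s≤s i≤r)) (T-* a Ty))
      where
      open ≡-Reasoning
      e : ∀ M B a x → M + B * (1 + a * x) ≡ M + B + a * (B * x)
      e = solve-∀
      e′ : ∀ M B a x y → M + B + a * (B * x + y) ≡ M + B * (1 + a * x) + a * y
      e′ = solve-∀

    S⊆T : S ⊆ T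
    S⊆T (gen (j , refl)) = T-gen j
    S⊆T 0∈ = 0 , 0 , sym (*-zeroʳ B) , V-0
    S⊆T (add x∈ y∈) = T-+ (S⊆T x∈) (S⊆T y∈)

    M∈S : M ∈ S
    M∈S = M∈⟨G⟩ a M B

    -- Each peeled repunit takes one copy of `M` to form a generator; the copies left at the end
    -- form a multiple of `M`.
    V⇒∈S : ∀ q {k} → V q k → k * M + B * q ∈ S
    V⇒∈S = <-rec (λ q → ∀ {k} → V q k → k * M + B * q ∈ S) step
      where
      e : ∀ M k B y x → M + B * y + (k * M + B * x) ≡ (1 + k) * M + B * (y + x)
      e = solve-∀
      step : ∀ q → (∀ {x} → x < q → ∀ {k} → V x k → k * M + B * x ∈ S) →
        ∀ {k} → V q k → k * M + B * q ∈ S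
      step zero _ {k} _ =
        subst (_∈ S) (sym (trans (cong (λ t → k * M + t) (*-zeroʳ B)) (+-identityʳ _))) (multiple∈ k M∈S)
      step q@(suc _) rec Vq with V-peel Vq z<s
      ... | i , x , k′ , _ , q≡ , refl , Vx = subst (λ t → suc k′ * M + B * t ∈ S) (sym q≡)
        (subst (_∈ S) (e M k′ B (R a (suc i)) x)
          (add (gen (suc i , refl)) (rec (subst (x <_) (sym q≡) (m<n+m x (0<R i))) Vx)))

    -- the Apéry element of M in the class of B * q
    w : ℕ → ℕ
    w q = B * q + κ q * M

    w+∈S : ∀ q z → w q + z * M ∈ S
    w+∈S q z = subst (_∈ S) (e (κ q) z M B q) (V⇒∈S q (κ≤⇒V {q} (m≤m+n (κ q) z)))
      where
      e : ∀ k z M B q → (k + z) * M + B * q ≡ B * q + k * M + z * M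
      e = solve-∀

    ∈S⇒w+ : ∀ {N} → N ∈ S → ∃[ q ] q < M × ∃[ z ] N ≡ w q + z * M
    ∈S⇒w+ N∈ with S⊆T N∈
    ... | k , q , refl , Vq = q₀ , m%n<n q M , z , (begin
      k * M + B * q                   ≡⟨ cong (λ t → k * M + B * t) q≡ ⟩
      k * M + B * (q₀ + v * M)        ≡⟨ e k M B q₀ v ⟩
      B * q₀ + (k + v * B) * M        ≡⟨ cong (λ t → B * q₀ + t * M) (m+[n∸m]≡n κ≤) ⟨
      B * q₀ + (κ q₀ + z) * M         ≡⟨ e′ (B * q₀) (κ q₀) z M ⟩
      w q₀ + z * M                    ∎)
      where
      open ≡-Reasoning
      instance
        M-nonZero : NonZero M
        M-nonZero = >-nonZero 0<M
      q₀ = q % M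
      v = q / M
      q≡ : q ≡ q₀ + v * M
      q≡ = m≡m%n+[m/n]*n q M
      -- Reducing `q` modulo `M` turns `B * (v * M)` into `v * B` further copies of `M`.
      κ≤ : κ q₀ ≤ k + v * B
      κ≤ = V⇒κ≤ (V-reduce* v (subst (λ t → V t k) q≡ Vq))
      z = k + v * B ∸ κ q₀
      e : ∀ k M B q v → k * M + B * (q + v * M) ≡ B * q + (k + v * B) * M
      e = solve-∀
      e′ : ∀ x k z M → x + (k + z) * M ≡ x + k * M + z * M
      e′ = solve-∀

    -- Positive evidence for `N ∉ S`: `N` lies below the Apéry element of its class by a positive
    -- multiple of `M`. This makes membership in `S` decidable.
    Gap : ℕ → Set
    Gap N = ∃[ q ] q < M × ∃[ z ] N + suc z * M ≡ w q

    Gap⇒∉S : ∀ {N} → Gap N → N ∉ S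
    Gap⇒∉S {N} (q , q<M , z , eq) N∈ with ∈S⇒w+ N∈
    ... | q′ , q′<M , z′ , refl
      with *-cancel-mod (κ q′ + z′ + suc z) (κ q) M⊥B q′<M q<M
             (trans (e (B * q′) (κ q′) z′ (suc z) M) eq)
      where
      e : ∀ x k y z M → x + (k + y + z) * M ≡ x + k * M + y * M + z * M
      e = solve-∀
    ...   | refl = contradiction (trans (sym (+-assoc (w q) (z′ * M) (suc z * M))) eq)
              (>⇒≢ (m<m+n (w q) (<-≤-trans 0<M (≤-trans (m≤m+n M (z * M)) (m≤n+m _ (z′ * M))))))

    ∈S⊎Gap : ∀ N → N ∈ S ⊎ Gap N
    ∈S⊎Gap N with residue 0<M M⊥B N
    -- Over `B * q` the number `N` carries `y - x` copies of `M`, to be compared with `κ q`.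
    ... | q , q<M , x , y , eq with x + κ q ≤? y
    ...   | yes x+κ≤y = inj₁ (subst (_∈ S) (sym N≡) (w+∈S q z))
      where
      open ≡-Reasoning
      z = y ∸ (x + κ q)
      e : ∀ p x k z M → p + (x + k + z) * M ≡ p + k * M + z * M + x * M
      e = solve-∀
      N≡ : N ≡ w q + z * M
      N≡ = +-cancelʳ-≡ (x * M) _ _ (begin
        N + x * M                       ≡⟨ eq ⟩
        B * q + y * M                   ≡⟨ cong (λ t → B * q + t * M) (m+[n∸m]≡n x+κ≤y) ⟨
        B * q + (x + κ q + z) * M       ≡⟨ e (B * q) x (κ q) z M ⟩
        w q + z * M + x * M             ∎)
    ...   | no x+κ≰y = inj₂ (q , q<M , z , +-cancelʳ-≡ ((x + y) * M) _ _ (begin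
        N + suc z * M + (x + y) * M     ≡⟨ e N z x y M ⟩
        N + x * M + (suc y + z) * M     ≡⟨ cong₂ (λ s t → s + t * M) eq (m+[n∸m]≡n (≰⇒> x+κ≰y)) ⟩
        B * q + y * M + (x + κ q) * M   ≡⟨ e′ (B * q) y x (κ q) M ⟩
        w q + (x + y) * M               ∎))
      where
      open ≡-Reasoning
      z = x + κ q ∸ suc y
      e : ∀ N z x y M → N + (1 + z) * M + (x + y) * M ≡ N + x * M + (1 + y + z) * M
      e = solve-∀
      e′ : ∀ p y x k M → p + y * M + (x + k) * M ≡ p + k * M + (x + y) * M
      e′ = solve-∀

    S? : ∀ N → Dec (N ∈ S)
    S? N with ∈S⊎Gap N
    ... | inj₁ N∈  = yes N∈
    ... | inj₂ gap = no (Gap⇒∉S gap)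

    -- The step from `p` to `p + R a (suc (ℓ p))` leaves the range of the Apéry indices.
    Final : ℕ → Set
    Final p = p < M × M ≤ p + R a (suc (ℓ p))

    -- One step of length `R a (suc (ℓ q))` adds a generator and, because `κ` grows by at least one,
    -- a nonnegative multiple of `M`; steps are repeated until the index is `Final`.
    w-climb : ∀ q → q < M → ∃[ p ] ∃[ s ] Final p × s ∈ S × w q + s ≡ w p
    -- `M` is enough fuel: every step raises the index, which stays below `M`.
    w-climb q q<M = climb M q q<M (m≤m+n M q)
      where
      open ≡-Reasoning
      e : ∀ B q y k M z → B * q + k * M + (M + B * y + z * M) ≡ B * (q + y) + (1 + k + z) * M
      e = solve-∀
      climb : ∀ n q → q < M → M ≤ n + q → ∃[ p ] ∃[ s ] Final p × s ∈ S × w q + s ≡ w p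
      climb zero    q q<M M≤q = contradiction M≤q (<⇒≱ q<M)
      climb (suc n) q q<M M≤ with M ≤? q + R a (suc (ℓ q))
      ... | yes M≤q+R = q , 0 , (q<M , M≤q+R) , 0∈ , +-identityʳ (w q)
      ... | no  M≰q+R with climb n (q + R a (suc (ℓ q))) (≰⇒> M≰q+R)
              (≤-trans M≤ (≤-trans (≤-reflexive (sym (+-suc n q))) (+-monoʳ-≤ n (m<m+n q (0<R (ℓ q))))))
      ...   | p , s , fin , s∈ , eq =
        p , _ , fin , add (add (gen (suc (ℓ q) , refl)) (multiple∈ z M∈S)) s∈ , (begin
        w q + (M + B * Rℓ + z * M + s)      ≡⟨ +-assoc (w q) _ s ⟨
        w q + (M + B * Rℓ + z * M) + s      ≡⟨ cong (_+ s) (e B q Rℓ (κ q) M z) ⟩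
        B * (q + Rℓ) + (suc (κ q) + z) * M + s
          ≡⟨ cong (λ t → B * (q + Rℓ) + t * M + s) (m+[n∸m]≡n (κ-step q)) ⟩
        w (q + Rℓ) + s                      ≡⟨ eq ⟩
        w p                                 ∎)
        where
        Rℓ = R a (suc (ℓ q))
        z = κ (q + Rℓ) ∸ suc (κ q)

    Final-unique : ∀ {p p′} → Final p → Final p′ → ℓ p ≡ ℓ p′ → p ≡ p′
    Final-unique {p} {p′} (p<M , M≤) (p′<M , M≤′) ℓ≡ with <-cmp p p′
    ... | tri< p<p′ _ _ = contradiction (≤-trans M≤ (ℓ-spacing ℓ≡ p<p′)) (<⇒≱ p′<M)
    ... | tri≈ _ p≡p′ _ = p≡p′
    ... | tri> _ _ p′<p = contradiction (≤-trans M≤′ (ℓ-spacing (sym ℓ≡) p′<p)) (<⇒≱ p<M)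

    -- The value 0 of `c` marks elements of `S`. A positive `c` names `ℓ p`, hence `p` by
    -- `Final-unique`, and `x` is recovered as `w p - M - s`.
    data Code (x s c : ℕ) : Set where
      element : c ≡ 0 → x ≡ s → Code x s c
      gap     : ∀ p → Final p → c ≡ suc (ℓ p) → x + s + M ≡ w p → Code x s c

    Code-unique : ∀ {x x′ s c} → Code x s c → Code x′ s c → x ≡ x′
    Code-unique (element _ refl) (element _ refl) = refl
    Code-unique (element refl _) (gap _ _ () _)
    Code-unique (gap _ _ refl _) (element () _)
    Code-unique {s = s} (gap p fin c≡ eq) (gap p′ fin′ c≡′ eq′)
      with refl ← Final-unique fin fin′ (suc-injective (trans (sym c≡) c≡′))
      = +-cancelʳ-≡ s _ _ (+-cancelʳ-≡ M _ _ (trans eq (sym eq′)))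

    -- The Frobenius number and the counting argument.

    max-w : ∃[ q ] q < M × (∀ {j} → j < M → w j ≤ w q)
    max-w = argmax w M 0<M

    -- The index 1 is below `M`, and `κ 1` is positive, so `w 1` is already at least `M`. Thus the
    -- subtraction defining `F` is exact.
    M≤max-w : M ≤ w (proj₁ max-w)
    M≤max-w = begin
      M               ≡⟨ *-identityˡ M ⟨
      1 * M           ≤⟨ *-monoˡ-≤ M (κ-pos {1} z<s) ⟩
      κ 1 * M         ≤⟨ m≤n+m _ (B * 1) ⟩
      w 1             ≤⟨ proj₂ (proj₂ max-w) 2≤M ⟩
      w (proj₁ max-w) ∎
      where open ≤-Reasoning

    F : ℕ
    F = w (proj₁ max-w) ∸ M

    F+M : F + M ≡ w (proj₁ max-w)
    F+M = m∸n+n≡m M≤max-w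

    F∉S : F ∉ S
    F∉S = Gap⇒∉S (_ , proj₁ (proj₂ max-w) , 0 , trans (cong (λ t → F + t) (+-identityʳ M)) F+M)

    x+s≤F : ∀ {x s q} → q < M → x + s + M ≡ w q → x + s ≤ F
    x+s≤F q<M eq = +-cancelʳ-≤ M _ _
      (≤-trans (≤-reflexive eq) (≤-trans (proj₂ (proj₂ max-w) q<M) (≤-reflexive (sym F+M))))

    gap-code : ∀ {x} → Gap x → ∃[ s ] ∃[ p ] Final p × s ∈ S × x + s + M ≡ w p
    gap-code {x} (q , q<M , z , eq) with w-climb q q<M
    ... | p , s , fin , s∈ , eq′ =
      z * M + s , p , fin , add (multiple∈ z M∈S) s∈ , trans (e x (z * M) s M) (trans (cong (_+ s) eq) eq′)
      where
      e : ∀ x y s M → x + (y + s) + M ≡ x + (M + y) + s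
      e = solve-∀

    frobenius : IsFrobenius S F
    frobenius = F∉S , λ x x∉S → gap≤F x x∉S (∈S⊎Gap x)
      where
      gap≤F : ∀ x → x ∉ S → x ∈ S ⊎ Gap x → x ≤ F
      gap≤F x x∉S (inj₁ x∈S) = contradiction x∈S x∉S
      gap≤F x _ (inj₂ g) with gap-code {x} g
      ... | s , p , (p<M , _) , _ , eq = ≤-trans (m≤m+n x s) (x+s≤F {x} {s} p<M eq)

    <F : ∀ {x} → x ∈ S → x ≤ F → x < F
    <F x∈ x≤F = ≤∧≢⇒< x≤F (λ { refl → F∉S x∈ })

    -- For a gap, `x + s ≡ w p - M ≤ F`, so `s ≤ F`; equality is impossible because `s ∈ S` and
    -- `F ∉ S`.
    code : ∀ {x} → x ≤ F → ∃[ s ] ∃[ c ] s ∈ S × s < F × c < suc r × Code x s c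
    code {x} x≤F with ∈S⊎Gap x
    ... | inj₁ x∈S = x , 0 , x∈S , <F x∈S x≤F , z<s , element refl refl
    ... | inj₂ g with gap-code {x} g
    ...   | s , p , fin , s∈ , eq = s , suc (ℓ p) , s∈ ,
              <F s∈ (≤-trans (m≤n+m s x) (x+s≤F {x} {s} (proj₁ fin) eq)) ,
              s<s (proj₁ (ℓ-spec p)) , gap p fin refl eq

    elements : List ℕ
    elements = filter S? (upTo F)

    elements⁺ : ∀ {x} → x ∈ S → x < F → x ∈ˡ elements
    elements⁺ x∈S x<F = ∈-filter⁺ S? (∈-upTo⁺ x<F) x∈S

    cardinality : HasCardinality (λ x → x ∈ S × x < F) (length elements)
    cardinality = elements , Unique.filter⁺ S? (Unique.upTo⁺ F) ,
      (λ x → mk⇔ (λ x∈ → let x∈up , x∈S = ∈-filter⁻ S? x∈ in x∈S , ∈-upTo⁻ x∈up)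
                 (λ (x∈S , x<F) → elements⁺ x∈S x<F)) ,
      refl

    -- The pair `(s , c)` of `code` as a single index, so that injectivity bounds `suc F` by the
    -- number of pairs.
    encode : Fin (suc F) → Fin (length elements * suc r)
    encode i with code (s≤s⁻¹ (toℕ<n i))
    ... | s , c , s∈ , s<F , c<1+r , _ = combine (index (elements⁺ s∈ s<F)) (fromℕ< c<1+r)

    encode-injective : ∀ {i j} → encode i ≡ encode j → i ≡ j
    encode-injective {i} {j} eq with code (s≤s⁻¹ (toℕ<n i)) | code (s≤s⁻¹ (toℕ<n j))
    ... | s , c , s∈ , s<F , c< , cd | s′ , c′ , s′∈ , s′<F , c′< , cd′
      with combine-injective _ (fromℕ< c<) _ (fromℕ< c′<) eq
    ...   | s≡ , c≡ with Membership.index-injective (setoid ℕ) (elements⁺ s∈ s<F) (elements⁺ s′∈ s′<F) s≡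
                       | trans (sym (toℕ-fromℕ< c<)) (trans (cong toℕ c≡) (toℕ-fromℕ< c′<))
    ...     | refl | refl = toℕ-injective (Code-unique cd cd′)

    F+1≤ : F + 1 ≤ length elements * suc r
    F+1≤ = subst (_≤ length elements * suc r) (+-comm 1 F) (injective⇒≤ encode-injective)

-- Cardinalities and generating sets.

cardinality-resp-≐ : ∀ {P Q k} → P ≐ Q → HasCardinality P k → HasCardinality Q k
cardinality-resp-≐ (P⊆Q , Q⊆P) (xs , unique , ∈⇔ , len) =
  xs , unique ,
  (λ x → mk⇔ (λ x∈ → P⊆Q (Equivalence.to (∈⇔ x) x∈)) (λ x∈ → Equivalence.from (∈⇔ x) (Q⊆P x∈))) ,
  len

injection⇒≤cardinality : ∀ {P k n} (f : ℕ → ℕ) → (∀ {i j} → f i ≡ f j → i ≡ j) →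
  (∀ {i} → i < n → f i ∈ P) → HasCardinality P k → n ≤ k
injection⇒≤cardinality {P} f f-inj f∈ (xs , _ , ∈⇔ , refl) =
  injective⇒≤ {f = λ i → index (mem i)} (λ {i} {j} eq →
    toℕ-injective (f-inj (Membership.index-injective (setoid ℕ) (mem i) (mem j) eq)))
  where
  mem : ∀ i → f (toℕ i) ∈ˡ xs
  mem i = Equivalence.from (∈⇔ _) (f∈ (toℕ<n i))

⊆singleton⇒cardinality≤1 : ∀ {P k z} → P ⊆ (_≡ z) → HasCardinality P k → k ≤ 1
⊆singleton⇒cardinality≤1 P⊆ ([] , _ , _ , refl) = z≤n
⊆singleton⇒cardinality≤1 P⊆ (_ ∷ [] , _ , _ , refl) = ≤-refl
⊆singleton⇒cardinality≤1 P⊆ (x ∷ y ∷ _ , (x≢y ∷ _) ∷ _ , ∈⇔ , refl) =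
  contradiction (trans (P⊆ (Equivalence.to (∈⇔ x) (here refl)))
    (sym (P⊆ (Equivalence.to (∈⇔ y) (there (here refl)))))) x≢y

irreducible∈generators : ∀ {A N z} → A Generates N → z ∈ N → 0 < z →
  (∀ {x y} → x ∈ N → y ∈ N → x + y ≡ z → x ≡ 0 ⊎ y ≡ 0) → z ∈ A
irreducible∈generators {A} {N} {z} (A⊆ , ⊇A) z∈N 0<z irr = go (⊇A z∈N) refl
  where
  go : ∀ {x} → x ∈ ⟨ A ⟩ → x ≡ z → z ∈ A
  go (gen x∈A) refl = x∈A
  go 0∈ 0≡z = contradiction 0≡z (<⇒≢ 0<z)
  go (add {x} {y} x∈ y∈) x+y≡z with irr (A⊆ x∈) (A⊆ y∈) x+y≡z
  ... | inj₁ refl = go y∈ x+y≡z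
  ... | inj₂ refl = go x∈ (trans (sym (+-identityʳ x)) x+y≡z)

-- Multiplication by a common divisor.

⟨⟩-scale : ∀ g {A B : Pred ℕ 0ℓ} → (∀ {y} → y ∈ A → g * y ∈ B) → ∀ {y} → y ∈ ⟨ A ⟩ → g * y ∈ ⟨ B ⟩
⟨⟩-scale g f (gen y∈) = gen (f y∈)
⟨⟩-scale g {B = B} f 0∈ = subst (_∈ ⟨ B ⟩) (sym (*-zeroʳ g)) 0∈
⟨⟩-scale g {B = B} f (add {x} {y} x∈ y∈) =
  subst (_∈ ⟨ B ⟩) (sym (*-distribˡ-+ g x y)) (add (⟨⟩-scale g f x∈) (⟨⟩-scale g f y∈))

⟨⟩-unscale : ∀ g {A B : Pred ℕ 0ℓ} → (∀ {x} → x ∈ A → ∃[ y ] y ∈ B × x ≡ g * y) →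
  ∀ {x} → x ∈ ⟨ A ⟩ → ∃[ y ] y ∈ ⟨ B ⟩ × x ≡ g * y
⟨⟩-unscale g f (gen x∈) with f x∈
... | y , y∈ , eq = y , gen y∈ , eq
⟨⟩-unscale g f 0∈ = 0 , 0∈ , sym (*-zeroʳ g)
⟨⟩-unscale g f (add x∈ x′∈) with ⟨⟩-unscale g f x∈ | ⟨⟩-unscale g f x′∈
... | y , y∈ , refl | y′ , y′∈ , refl = y + y′ , add y∈ y′∈ , sym (*-distribˡ-+ g y y′)

module _ {g : ℕ} .{{_ : NonZero g}} {X Y : Pred ℕ 0ℓ}
  (X⊆gY : ∀ {x} → x ∈ X → ∃[ y ] y ∈ Y × x ≡ g * y) (gY⊆X : ∀ {y} → y ∈ Y → g * y ∈ X) where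

  private
    g*-injective : ∀ {x y} → g * x ≡ g * y → x ≡ y
    g*-injective {x} {y} = *-cancelˡ-≡ x y g

    g*∈X⇒∈Y : ∀ {y} → g * y ∈ X → y ∈ Y
    g*∈X⇒∈Y gy∈X with X⊆gY gy∈X
    ... | y′ , y′∈Y , eq = subst (_∈ Y) (sym (g*-injective eq)) y′∈Y

    map-preimage : ∀ xs → (∀ {x} → x ∈ˡ xs → ∃[ y ] x ≡ g * y) → ∃[ ys ] xs ≡ map (g *_) ys
    map-preimage [] f = [] , refl
    map-preimage (x ∷ xs) f with f (here refl) | map-preimage xs (λ x∈ → f (there x∈))
    ... | y , refl | ys , refl = y ∷ ys , refl

  -- Multiplication by `g` is an isomorphism of `Y` onto `X`, so the minimal generating set of `Y`
  -- is the preimage of that of `X`.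
  embeddingDimension-scale : ∀ {m} → IsEmbeddingDimension X m → IsEmbeddingDimension Y m
  embeddingDimension-scale {m} (A , ((⟨A⟩⊆X , X⊆⟨A⟩) , minimal) , (xs , unique , ∈⇔ , len)) =
    A′ , ((⟨A′⟩⊆Y , Y⊆⟨A′⟩) , minimal′) , card
    where
    A′ : Pred ℕ 0ℓ
    A′ y = g * y ∈ A
    A⊆gA′ : ∀ {x} → x ∈ A → ∃[ y ] y ∈ A′ × x ≡ g * y
    A⊆gA′ x∈A with X⊆gY (⟨A⟩⊆X (gen x∈A))
    ... | y , _ , eq = y , subst (_∈ A) eq x∈A , eq
    ⟨A′⟩⊆Y : ⟨ A′ ⟩ ⊆ Y
    ⟨A′⟩⊆Y y∈ = g*∈X⇒∈Y (⟨A⟩⊆X (⟨⟩-scale g (λ y∈A′ → y∈A′) y∈))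
    Y⊆⟨A′⟩ : Y ⊆ ⟨ A′ ⟩
    Y⊆⟨A′⟩ y∈Y with ⟨⟩-unscale g A⊆gA′ (X⊆⟨A⟩ (gY⊆X y∈Y))
    ... | y′ , y′∈ , eq = subst (_∈ ⟨ A′ ⟩) (sym (g*-injective eq)) y′∈
    minimal′ : ∀ B → B Generates Y → A′ ⊆ B
    -- A generating set `B` of `Y` is tested through its image `gB`, which generates `X`.
    minimal′ B (⟨B⟩⊆Y , Y⊆⟨B⟩) y∈A′ with minimal gB (⟨gB⟩⊆X , X⊆⟨gB⟩) y∈A′
      where
      gB : Pred ℕ 0ℓ
      gB x = ∃[ y ] y ∈ B × x ≡ g * y
      ⟨gB⟩⊆X : ⟨ gB ⟩ ⊆ X
      ⟨gB⟩⊆X x∈ with ⟨⟩-unscale g (λ x∈gB → x∈gB) x∈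
      ... | y , y∈ , refl = gY⊆X (⟨B⟩⊆Y y∈)
      X⊆⟨gB⟩ : X ⊆ ⟨ gB ⟩
      X⊆⟨gB⟩ x∈X with X⊆gY x∈X
      ... | y , y∈Y , refl = ⟨⟩-scale g (λ y∈B → _ , y∈B , refl) (Y⊆⟨B⟩ y∈Y)
    ... | y′ , y′∈B , eq = subst (_∈ B) (sym (g*-injective eq)) y′∈B
    card : HasCardinality A′ m
    card with map-preimage xs (λ {x} x∈ → let y , _ , eq = A⊆gA′ (Equivalence.to (∈⇔ x) x∈) in y , eq)
    ... | ys , refl = ys , Unique.map⁻ unique ,
      (λ y → mk⇔ (λ y∈ → Equivalence.to (∈⇔ (g * y)) (∈-map⁺ (g *_) y∈))
                 (λ y∈A′ → ∈-preimage (Equivalence.from (∈⇔ (g * y)) y∈A′))) ,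
      trans (sym (length-map (g *_) ys)) len
      where
      ∈-preimage : ∀ {y} → g * y ∈ˡ map (g *_) ys → y ∈ˡ ys
      ∈-preimage gy∈ with ∈-map⁻ (g *_) gy∈
      ... | y′ , y′∈ , eq = subst (_∈ˡ ys) (sym (g*-injective eq)) y′∈

-- Irreducible generators and the bound on `M`.

module _ {b M B : ℕ} where

  open Repunit b

  ⟨G⟩-form : ∀ {x} → x ∈ ⟨ G a M B ⟩ → x ≡ 0 ⊎ ∃[ k ] ∃[ q ] x ≡ B * q + suc k * M
  ⟨G⟩-form (gen (j , refl)) =
    inj₂ (0 , R a j , trans (+-comm M _) (cong (λ t → B * R a j + t) (sym (+-identityʳ M))))
  ⟨G⟩-form 0∈ = inj₁ refl
  ⟨G⟩-form (add {y = y} x∈ y∈) with ⟨G⟩-form x∈ | ⟨G⟩-form y∈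
  ... | inj₁ refl            | form-y               = form-y
  ... | inj₂ (k , q , refl)  | inj₁ refl            = inj₂ (k , q , +-identityʳ _)
  ... | inj₂ (k , q , refl)  | inj₂ (k′ , q′ , refl) = inj₂ (k + suc k′ , q + q′ , e B q k q′ k′ M)
    where
    e : ∀ B q k q′ k′ M → B * q + (1 + k) * M + (B * q′ + (1 + k′) * M)
      ≡ B * (q + q′) + (1 + (k + (1 + k′))) * M
    e = solve-∀

  module _ (0<M : 0 < M) (M⊥B : Coprime M B) where

    -- Two nonzero summands contain at least two copies of `M`. Cancelling one leaves `B * (q + q′)
    -- + suc (k + k′) * M ≡ B * R a j`: impossible modulo `M` if `q + q′ < R a j`, and by size
    -- otherwise.
    small-generator-irreducible : ∀ {j} → R a j < M → ∀ {x y} →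
      x ∈ ⟨ G a M B ⟩ → y ∈ ⟨ G a M B ⟩ → x + y ≡ M + B * R a j → x ≡ 0 ⊎ y ≡ 0
    small-generator-irreducible {j} Rj<M x∈ y∈ eq with ⟨G⟩-form x∈ | ⟨G⟩-form y∈
    ... | inj₁ x≡0 | _ = inj₁ x≡0
    ... | inj₂ _   | inj₁ y≡0 = inj₂ y≡0
    ... | inj₂ (k , q , refl) | inj₂ (k′ , q′ , refl) = contradiction eq′ (no-solution (<-≤-connex _ _))
      where
      open ≡-Reasoning
      e : ∀ B q k q′ k′ M → B * q + (1 + k) * M + (B * q′ + (1 + k′) * M)
        ≡ M + (B * (q + q′) + (1 + (k + k′)) * M)
      e = solve-∀
      eq′ : B * (q + q′) + suc (k + k′) * M ≡ B * R a j + 0 * M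
      eq′ = trans (+-cancelˡ-≡ M _ _ (trans (sym (e B q k q′ k′ M)) eq)) (sym (+-identityʳ _))
      no-solution : q + q′ < R a j ⊎ R a j ≤ q + q′ → ¬ B * (q + q′) + suc (k + k′) * M ≡ B * R a j + 0 * M
      no-solution (inj₁ <Rj) = *-distinct-mod (suc (k + k′)) 0 M⊥B <Rj Rj<M
      no-solution (inj₂ Rj≤) = >⇒≢ (+-mono-≤-< (*-monoʳ-≤ B Rj≤) (<-≤-trans 0<M (m≤m+n M _)))

    -- If `M` were 1, the semigroup would be all of ℕ, with 1 as its only minimal generator.
    e≥2⇒M≥2 : ∀ {m} → IsEmbeddingDimension ⟨ G a M B ⟩ m → 2 ≤ m → 2 ≤ M
    e≥2⇒M≥2 {m} (A , (_ , minimal) , card) 2≤m = ≤∧≢⇒< 0<M λ 1≡M →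
      <⇒≱ 2≤m (⊆singleton⇒cardinality≤1 (minimal (_≡ 1) (generates 1≡M)) card)
      where
      ∈-of-1 : ∀ {P : Pred ℕ 0ℓ} → 1 ∈ ⟨ P ⟩ → ∀ {x} → x ∈ ⟨ P ⟩
      ∈-of-1 {P} 1∈ {x} = subst (_∈ ⟨ P ⟩) (*-identityʳ x) (multiple∈ x 1∈)
      generates : 1 ≡ M → (_≡ 1) Generates ⟨ G a M B ⟩
      generates 1≡M =
        (λ _ → ∈-of-1 (subst (_∈ ⟨ G a M B ⟩) (sym 1≡M) (M∈⟨G⟩ a M B))) ,
        (λ _ → ∈-of-1 (gen refl))

    -- Otherwise the m + 1 generators M + B R_j, j ≤ m, would all be irreducible.
    M≤R[e] : ∀ {m} → 2 ≤ M → IsEmbeddingDimension ⟨ G a M B ⟩ m → M ≤ R a m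
    M≤R[e] {m} 2≤M (A , (generates , _) , card) = ≮⇒≥ λ R<M →
      1+n≰n (injection⇒≤cardinality (λ j → M + B * R a j)
        (λ {i} {j} eq → R-injective (*-cancelˡ-≡ (R a i) (R a j) B (+-cancelˡ-≡ M _ _ eq)))
        (λ {j} j<1+m → irreducible∈generators generates (gen (j , refl)) (<-≤-trans 0<M (m≤m+n M _))
          (small-generator-irreducible {j} (≤-<-trans (R-mono-≤ (s≤s⁻¹ j<1+m)) R<M)))
        card)
      where
      -- For `B` zero, `M` would be a common divisor of `M` and `B`, hence 1. Injectivity of
      -- `λ j → M + B * R a j` rests on this.
      B≢0 : B ≢ 0
      B≢0 refl = >⇒≢ 2≤M (M⊥B (divides 1 (sym (*-identityˡ M)) , M ∣0))
      instance
        B-nonZero : NonZero B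
        B-nonZero = ≢-nonZero B≢0

-- From the integers `s_j` to the normalised generators.

s-≡ : ∀ b c d n j → s (suc b) c d n j ≡ s (suc b) c d n 0 ℤ.+ + (b * (c * suc b ^ n) * R (suc b) j)
s-≡ b c d n j = begin
  + (c * a ^ (n + j)) ℤ.- d                   ≡⟨ cong (λ t → + t ℤ.- d) power ⟩
  (+ C₀ ℤ.+ + D) ℤ.- d                        ≡⟨ ℤ.+-assoc (+ C₀) (+ D) (ℤ.- d) ⟩
  + C₀ ℤ.+ (+ D ℤ.- d)                        ≡⟨ cong (λ t → + C₀ ℤ.+ t) (ℤ.+-comm (+ D) (ℤ.- d)) ⟩
  + C₀ ℤ.+ (ℤ.- d ℤ.+ + D)                    ≡⟨ ℤ.+-assoc (+ C₀) (ℤ.- d) (+ D) ⟨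
  (+ C₀ ℤ.- d) ℤ.+ + D                        ∎
  where
  open ≡-Reasoning
  open Repunit b
  C₀ = c * a ^ (n + 0)
  D = b * (c * a ^ n) * R a j
  e : ∀ b c x y → c * (x * (b * y + 1)) ≡ c * x + b * (c * x) * y
  e = solve-∀
  power : c * a ^ (n + j) ≡ C₀ + D
  power = begin
    c * a ^ (n + j)                 ≡⟨ cong (c *_) (^-distribˡ-+-* a n j) ⟩
    c * (a ^ n * a ^ j)             ≡⟨ cong (λ t → c * (a ^ n * t)) (b*R+1 j) ⟨
    c * (a ^ n * (b * R a j + 1))   ≡⟨ e b c (a ^ n) (R a j) ⟩
    c * a ^ n + D                   ≡⟨ cong (λ t → c * a ^ t + D) (+-identityʳ n) ⟨
    C₀ + D                          ∎

-- For `n ≥ 1` the power `c * a ^ n` is at least `c * a`, which exceeds `d`.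
s₀-positive : ∀ a c d n → 1 ≤ a → d ℤ.< + (c * a) → 1 ≤ n → ∃[ p ] 0 < p × s a c d n 0 ≡ + p
s₀-positive a c d (suc n) 1≤a d<ca _ = positive (s a c d (suc n) 0) refl
  where
  instance
    a^-nonZero : NonZero (a ^ (n + 0))
    a^-nonZero = >-nonZero (m^n>0 a ⦃ >-nonZero 1≤a ⦄ (n + 0))
  0<s : + 0 ℤ.< s a c d (suc n) 0
  0<s = ℤ.<-≤-trans (ℤ.≤-<-trans (ℤ.≤-reflexive (sym (ℤ.+-inverseʳ d))) (ℤ.+-monoˡ-< (ℤ.- d) d<ca))
    (ℤ.+-monoˡ-≤ (ℤ.- d) (ℤ.+≤+ (*-monoʳ-≤ c (m≤m*n a (a ^ (n + 0))))))
  positive : ∀ z → z ≡ s a c d (suc n) 0 → ∃[ p ] 0 < p × s a c d (suc n) 0 ≡ + p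
  positive (+ p) z≡ = p , ℤ.drop‿+<+ (subst (+ 0 ℤ.<_) (sym z≡) 0<s) , sym z≡
  positive -[1+ k ] z≡ with () ← subst (+ 0 ℤ.<_) (sym z≡) 0<s

module _ {g : ℕ} .{{_ : NonZero g}} {X : Pred ℕ 0ℓ} {a M B : ℕ}
  (X⊆gS : ∀ {x} → x ∈ X → ∃[ y ] y ∈ ⟨ G a M B ⟩ × x ≡ g * y)
  (gS⊆X : ∀ {y} → y ∈ ⟨ G a M B ⟩ → g * y ∈ X) where

  -- A common divisor `h` of `M` and `B` divides every generator, so `h * g` divides all of `X` and
  -- therefore `g`.
  gcd⇒coprime : IsGCD X g → Coprime M B
  gcd⇒coprime (_ , greatest) {h} (h∣M , h∣B) =
    ∣1⇒≡1 (*-cancelʳ-∣ g (subst (h * g ∣_) (sym (*-identityˡ g)) (greatest (h * g) hg∣)))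
    where
    h∣S : ∀ {y} → y ∈ ⟨ G a M B ⟩ → h ∣ y
    h∣S (gen (j , refl)) = ∣m∣n⇒∣m+n h∣M (∣m⇒∣m*n (R a j) h∣B)
    h∣S 0∈               = h ∣0
    h∣S (add x∈ y∈)      = ∣m∣n⇒∣m+n (h∣S x∈) (h∣S y∈)
    hg∣ : ∀ x → x ∈ X → h * g ∣ x
    hg∣ x x∈ with X⊆gS x∈
    ... | y , y∈ , refl = subst (h * g ∣_) (*-comm y g) (*-monoˡ-∣ g (h∣S y∈))

  1/g·X≐S : (1/ g · X) ≐ ⟨ G a M B ⟩
  1/g·X≐S = to , λ {y} y∈ → g * y , gS⊆X y∈ , sym (g*/g y)
    where
    g*/g : ∀ y → g * y / g ≡ y
    g*/g y = trans (cong (_/ g) (*-comm g y)) (m*n/n≡m y g)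
    to : (1/ g · X) ⊆ ⟨ G a M B ⟩
    to (x , x∈ , refl) with X⊆gS x∈
    ... | y , y∈ , refl = subst (_∈ ⟨ G a M B ⟩) (sym (g*/g y)) y∈

wilf-scaled : ∀ {g} .{{_ : NonZero g}} {X b M B m} →
  (∀ {x} → x ∈ X → ∃[ y ] y ∈ ⟨ G (suc b) M B ⟩ × x ≡ g * y) →
  (∀ {y} → y ∈ ⟨ G (suc b) M B ⟩ → g * y ∈ X) →
  0 < M → IsGCD X g → IsEmbeddingDimension X m → 2 ≤ m → R (suc b) m ≤ M + B →
  Wilf (1/ g · X)
wilf-scaled {m = suc zero} _ _ _ _ _ (s≤s ()) _
wilf-scaled {g} {X} {b} {M} {B} {m@(suc (suc r′))} X⊆gS gS⊆X 0<M isGCD dim 2≤m R≤M+B =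
  F , length elements , m ,
  ((λ F∈W → F∉S (W⊆S F∈W)) , λ x x∉W → proj₂ frobenius x (λ x∈S → x∉W (S⊆W x∈S))) ,
  cardinality-resp-≐ ((λ (x∈S , x<F) → S⊆W x∈S , x<F) , (λ (x∈W , x<F) → W⊆S x∈W , x<F)) cardinality ,
  embeddingDimension-scale {g = g} X⊆gW (λ y∈W → gS⊆X (W⊆S y∈W)) dim ,
  F+1≤
  where
  W⊆S : (1/ g · X) ⊆ ⟨ G (suc b) M B ⟩
  W⊆S = proj₁ (1/g·X≐S {a = suc b} {M} {B} X⊆gS gS⊆X)
  S⊆W : ⟨ G (suc b) M B ⟩ ⊆ (1/ g · X)
  S⊆W = proj₂ (1/g·X≐S {a = suc b} {M} {B} X⊆gS gS⊆X)
  X⊆gW : ∀ {x} → x ∈ X → ∃[ y ] y ∈ (1/ g · X) × x ≡ g * y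
  X⊆gW x∈X = let y , y∈S , x≡ = X⊆gS x∈X in y , S⊆W y∈S , x≡
  dim′ : IsEmbeddingDimension ⟨ G (suc b) M B ⟩ m
  dim′ = embeddingDimension-scale {g = g} X⊆gS gS⊆X dim
  M⊥B : Coprime M B
  M⊥B = gcd⇒coprime {a = suc b} X⊆gS gS⊆X isGCD
  2≤M : 2 ≤ M
  2≤M = e≥2⇒M≥2 0<M M⊥B dim′ 2≤m
  -- As `m` is `suc (suc r′)`, the number `R a (suc r)` is `R a m`. Its lower bound `M` comes from
  -- the embedding dimension, its upper bound `M + B` from the assumption on `s_1 / λ`.
  open Inverse b r′
  open Semigroup M B 2≤M M⊥B (M≤R[e] 0<M M⊥B 2≤M dim′) R≤M+B

mainTheorem8 : ∀ (a c : ℕ) (d : ℤ) (n : ℕ) →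
    2 ≤ a → 0 < c → d ℤ.< + (c * a) →
    gcd d (+ a) ≡ 1ℤ → gcd d (+ c) ≡ 1ℤ →
    1 ≤ n →
    ∀ (m : ℕ) → IsEmbeddingDimension (𝕊 a c d n) m → 2 ≤ m →
    ∀ (g : ℕ) .{{_ : NonZero g}} → IsGCD (𝕊 a c d n) g →
    + R a m ℤ.≤ s a c d n 1 /ℕ g →
    Wilf (1/ g · 𝕊 a c d n)
mainTheorem8 a@(suc b) c d n 2≤a _ d<ca _ _ 1≤n m dim 2≤m g isGCD@(g∣ , _) R≤
  with s₀-positive a c d n (<⇒≤ 2≤a) d<ca 1≤n
... | p , 0<p , s₀≡ = wilf-scaled {g = g} {b = b}
    (⟨⟩-unscale g (λ (j , x≡) → M + B * R a j , (j , refl) , ℤ.+-injective (trans x≡ (sⱼ≡g* j))))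
    (⟨⟩-scale g (λ { (j , refl) → j , sym (sⱼ≡g* j) }))
    0<M isGCD dim 2≤m R≤M+B
  where
  D : ℕ
  D = b * (c * a ^ n)
  sⱼ≡ : ∀ j → s a c d n j ≡ + (p + D * R a j)
  sⱼ≡ j = trans (s-≡ b c d n j) (cong (λ t → t ℤ.+ + (D * R a j)) s₀≡)
  sⱼ∈𝕊 : ∀ j → p + D * R a j ∈ 𝕊 a c d n
  sⱼ∈𝕊 j = gen (j , sym (sⱼ≡ j))
  g∣p : g ∣ p
  g∣p = subst (g ∣_) (trans (cong (λ t → p + t) (*-zeroʳ D)) (+-identityʳ p)) (g∣ _ (sⱼ∈𝕊 0))
  g∣D : g ∣ D
  -- Since `R a 1` is 1, `D` is the difference of the generators for `j` equal to 1 and 0.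
  g∣D = subst (g ∣_) (*-identityʳ D) (∣m+n∣m⇒∣n (g∣ _ (sⱼ∈𝕊 1)) g∣p)
  M : ℕ
  M = _∣_.quotient g∣p
  B : ℕ
  B = _∣_.quotient g∣D
  sⱼ≡g* : ∀ j → s a c d n j ≡ + (g * (M + B * R a j))
  sⱼ≡g* j = trans (sⱼ≡ j) (cong (λ t → + t) (trans
    (cong₂ (λ x y → x + y * R a j) (_∣_.equality g∣p) (_∣_.equality g∣D)) (e g M B (R a j))))
    where
    e : ∀ g M B x → M * g + B * g * x ≡ g * (M + B * x)
    e = solve-∀
  0<M : 0 < M
  0<M = n≢0⇒n>0 (λ M≡0 → >⇒≢ 0<p (trans (_∣_.equality g∣p) (cong (_* g) M≡0)))
  R≤M+B : R a m ≤ M + B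
  R≤M+B = begin
    R a m                     ≤⟨ ℤ.drop‿+≤+ (subst (λ t → + R a m ℤ.≤ t /ℕ g) (sⱼ≡g* 1) R≤) ⟩
    g * (M + B * 1) / g       ≡⟨ cong (_/ g) (*-comm g (M + B * 1)) ⟩
    (M + B * 1) * g / g       ≡⟨ m*n/n≡m (M + B * 1) g ⟩
    M + B * 1                 ≡⟨ cong (λ t → M + t) (*-identityʳ B) ⟩
    M + B                     ∎
    where open ≤-Reasoning
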